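{- The smallest order (number of vertices) of a triangle-free planar graph $G$ with $\chi_1(G)=3$ is $11$; that is, $f(3,1;\mathrm{planar})=11$.
   Context: All graphs are finite, undirected, with no loops or multiple edges. For a nonnegative integer $k$, a subset $U\subseteq V(G)$ is $k$-independent if the induced subgraph $G[U]$ has maximum degree at most $k$. A graph $G$ is $(m,k)$-colourable if its vertices can be assigned $m$ colours (one colour per vertex) so that for each colour the set of all vertices receiving that colour is $k$-independent. The $k$-defective chromatic number $\chi_k(G)$ is the smallest integer $m$ for which $G$ is $(m,k)$-colourable. $f(m,k;\mathrm{planar})$ denotes the smallest order of a triangle-free planar graph $G$ with $\chi_k(G)=m$. -}

module Defs where

open import Data.Bool using (Bool; T)
open import Data.Fin using (Fin; _≟_)
open import Data.Fin.Subset using (Subset; _∈_; _∩_; ∣_∣)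
open import Data.Nat using (ℕ; _+_; _*_; _≤_)
open import Data.Product using (Σ; ∃; _×_)
open import Data.Sum using (_⊎_)
open import Data.Vec using (tabulate)
open import Function using (_∘_)
open import Function.Bundles using (_⇔_; _↔_; _↠_; module Inverse; module Surjection)
open import Level using (0ℓ)
open import Relation.Binary using (Rel)
open import Relation.Binary.Construct.Closure.Equivalence using (EqClosure)
open import Relation.Binary.PropositionalEquality using (_≡_)
open import Relation.Nullary using (¬_)
open import Relation.Nullary.Decidable using (⌊_⌋)

-- Simple graphs of order n. The adjacency matrix is Boolean so that
-- adjacency is decidable and proof-irrelevant.
record Graph (n : ℕ) : Set where
  field
    adj : Fin n → Fin n → Bool

  Adj : Rel (Fin n) 0ℓ
  Adj u v = T (adj u v)

  field
    symmetric   : ∀ u v → Adj u v → Adj v u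
    irreflexive : ∀ v → ¬ Adj v v

  neighbours : Fin n → Subset n
  neighbours v = tabulate (adj v)

-- Minimum of a set of natural numbers, as a relation: IsLeast P m says that
-- the set P is inhabited and that its smallest element is m.
IsLeast : (ℕ → Set) → ℕ → Set
IsLeast P m = P m × (∀ j → P j → m ≤ j)

module _ {n : ℕ} (G : Graph n) where
  open Graph G

  TriangleFree : Set
  TriangleFree = ∀ u v w → Adj u v → Adj v w → ¬ Adj u w

  -- For v ∈ U, the degree of v in G[U] is ∣ U ∩ neighbours v ∣.
  Independent : (k : ℕ) → Subset n → Set
  Independent k U = ∀ v → v ∈ U → ∣ U ∩ neighbours v ∣ ≤ k

  colourClass : ∀ {m} → (Fin n → Fin m) → Fin m → Subset n
  colourClass c i = tabulate (λ v → ⌊ c v ≟ i ⌋)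

  Colourable : (m k : ℕ) → Set
  Colourable m k = ∃ λ (c : Fin n → Fin m) → ∀ i → Independent k (colourClass c i)

  -- DefectiveChromaticNumber k m says χ_k(G) = m.
  DefectiveChromaticNumber : (k m : ℕ) → Set
  DefectiveChromaticNumber k = IsLeast (λ m → Colourable m k)

-- The equivalence relation generated by R has exactly c classes:
-- they are the fibres of a surjection onto Fin c.
ClassCount : {A : Set} → Rel A 0ℓ → ℕ → Set
ClassCount {A} R c =
  Σ (A ↠ Fin c) λ f →
    ∀ x y → Surjection.to f x ≡ Surjection.to f y ⇔ EqClosure R x y

-- The orbits of a permutation p of a finite set are the classes of the
-- equivalence relation generated by Step p.
Step : {A : Set} → (A → A) → Rel A 0ℓ
Step p x y = p x ≡ y

-- Planarity is expressed by combinatorial maps (rotation systems), the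
-- discrete description of cellular embeddings in closed oriented surfaces.
module _ {n : ℕ} (G : Graph n) where
  open Graph G

  -- An edge with a choice of direction.
  record Dart : Set where
    constructor dart
    field
      tail head : Fin n
      adjacent  : Adj tail head
  open Dart

  reverse : Dart → Dart
  reverse (dart u v e) = dart v u (symmetric u v e)

  -- A permutation of the darts that permutes the darts leaving each vertex in
  -- a single cycle: the cyclic order in which edges leave that vertex.
  record RotationSystem : Set where
    field
      rotation : Dart ↔ Dart

    rotate : Dart → Dart
    rotate = Inverse.to rotation

    field
      cyclic : ∀ d e → tail d ≡ tail e ⇔ EqClosure (Step rotate) d e

    -- The face permutation: walk along d, then leave its head by the edge
    -- following d in the rotation there. Its orbits are the face boundaries.
    faceStep : Dart → Dart
    faceStep = rotate ∘ reverse

    Linked : Rel Dart 0ℓ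
    Linked d e = rotate d ≡ e ⊎ reverse d ≡ e

    -- Euler's formula V - E + F = 2C, where V, E, F, C count the vertices,
    -- edges, faces and connected components of the map. Each component
    -- satisfies V - E + F = 2 - 2g with genus g ≥ 0, so the sum over all
    -- components forces every genus to be 0. Isolated vertices carry no
    -- darts, so they are absent from V, F and C alike; they are irrelevant
    -- to embeddability.
    Spherical : Set
    Spherical =
      ∃ λ V → ∃ λ E → ∃ λ F → ∃ λ C →
        ClassCount (Step rotate)   V ×
        ClassCount (Step reverse)  E ×
        ClassCount (Step faceStep) F ×
        ClassCount Linked          C ×
        V + F ≡ E + 2 * C

  -- A graph embeds in the plane iff each of its components embeds in the sphere.
  Planar : Set
  Planar = Σ RotationSystem RotationSystem.Spherical

-- The orders of triangle-free planar graphs G with χ_k(G) = m.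
PlanarOrder : (m k : ℕ) → ℕ → Set
PlanarOrder m k n =
  Σ (Graph n) λ G → TriangleFree G × Planar G × DefectiveChromaticNumber G k m

-- MinimumPlanarOrder m k n says f(m, k; planar) = n.
MinimumPlanarOrder : (m k : ℕ) → ℕ → Set
MinimumPlanarOrder m k = IsLeast (PlanarOrder m k)

{-# OPTIONS --safe #-}

-- A triangle-free plane graph on N non-isolated vertices with X darts has only
-- faces of length at least 4 unless some edge is a component, so Euler's formula
-- gives X + 8 ≤ 4 N, and every dart by which the faces exceed length 4 makes
-- this stricter by one. Hence a graph with X + 8 = 4 N is a quadrangulation, in
-- which cyclically consecutive neighbours of a vertex v have a common neighbour
-- other than v; if X + 10 = 4 N and there is a pendant vertex, then its face is
-- a hexagon and the same holds away from the pendant edge. Every triangle-free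
-- graph of order 10 without a (2,1)-colouring violates one of these conditions.
-- If its maximum degree is at most 3 it has such a colouring, namely one with
-- fewest monochromatic edges (Lovász). Otherwise fix v of degree Δ ≥ 4: at most
-- five vertices remain besides v and its neighbours, and as the neighbourhood of
-- v is independent, the graph is given by the graph on the remaining vertices
-- together with a multiset of Δ independent sets in it. These are enumerated by
-- evaluation. Smaller graphs are padded with isolated vertices.
module Submission where

open import Defs

import Algebra.Properties.CommutativeMonoid.Sum as Sum
open import Data.Bool using (Bool; true; false; T; _∧_; _∨_; not; if_then_else_)
import Data.Bool.Properties as Bool
open import Data.Bool.Properties using (T?; T-≡; T-∧; T-irrelevant)
import Data.Fin as Fin
open import Data.Fin using (Fin; zero; suc; toℕ; punchIn; splitAt; _↑ˡ_)
import Data.Fin.Properties as Fin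
open import Data.Fin.Subset using (Subset; inside; outside; _∩_; ∣_∣; Empty) renaming (_∈_ to _∈ˢ_)
import Data.Fin.Subset.Properties as Subset
import Data.List as List
open import Data.List using (List; []; _∷_; length; filter; allFin; cartesianProduct; cartesianProductWith; _ʳ++_)
import Data.List.Membership.DecPropositional as DecMembership
open import Data.List.Membership.Propositional using (_∈_; find)
open import Data.List.Membership.Propositional.Properties
import Data.List.Properties as List
open import Data.List.Relation.Binary.Permutation.Propositional using (_↭_; ↭-refl; ↭-sym; ↭-trans; ↭-reflexive; ↭⇒↭ₛ; prep)
open import Data.List.Relation.Binary.Permutation.Propositional.Properties using (shift; ↭-length; ∈-resp-↭; All-resp-↭; filter-↭; ++⁺ʳ; ++⁺ˡ)
import Data.List.Relation.Binary.Permutation.Setoid.Properties as Permutationₛ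
import Data.List.Relation.Unary.All as All
open import Data.List.Relation.Unary.All using (All; []; _∷_)
import Data.List.Relation.Unary.All.Properties as All
open import Data.List.Relation.Unary.AllPairs using ([]; _∷_)
import Data.List.Relation.Unary.Any as Any
open import Data.List.Relation.Unary.Any using (here; there)
import Data.List.Relation.Unary.Linked as Linked
open import Data.List.Relation.Unary.Linked using (_∷_)
open import Data.List.Relation.Unary.Unique.Propositional using (Unique)
import Data.List.Relation.Unary.Unique.Propositional.Properties as Unique
import Data.List.Sort as Sort
open import Data.Nat using (ℕ; zero; suc; _+_; _*_; _∸_; _≤_; _<_; _≤?_; _<?_; _≤ᵇ_; z≤n; s≤s)
open import Data.Nat.DivMod using (_mod_)
open import Data.Nat.Induction using (Acc; acc; <-wellFounded)
import Data.Nat.Properties as ℕ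
open import Data.Nat.Solver using (module +-*-Solver)
open import Data.Product using (_×_; _,_; ∃; ∃₂; proj₁; proj₂)
open import Data.Sum using (_⊎_; inj₁; inj₂; [_,_]′)
open import Data.Unit using (tt)
import Data.Vec as Vec
open import Data.Vec using (Vec; []; _∷_; lookup; map; zipWith; replicate; _++_; toList; tabulate)
import Data.Vec.Functional as Functional
open import Data.Vec.Functional.Properties using (updateAt-updates; updateAt-minimal)
open import Data.Vec.Membership.Propositional.Properties using (∈-toList⁻)
open import Data.Vec.Properties using (lookup-map; lookup-zipWith; map-++; ≡-dec; []=⇒lookup; lookup⇒[]=; lookup∘tabulate; tabulate-cong)
import Data.Vec.Relation.Unary.Any as VecAny
open import Data.Vec.Relation.Unary.Any.Properties using (lookup-index)
open import Function using (_∘_; id; _⇔_; mk⇔; Equivalence; Inverse)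
open import Function.Bundles using (mk↔ₛ′; mk↠ₛ; Surjection)
open import Level using (0ℓ)
open import Relation.Binary using (Rel; tri<; tri≈; tri>)
import Relation.Binary.Construct.Closure.Equivalence as EqClosure
open import Relation.Binary.Construct.Closure.Equivalence using (EqClosure)
import Relation.Binary.Construct.On as On
open import Relation.Binary.PropositionalEquality
open import Relation.Nullary using (¬_; Dec; yes; no; ¬?; contradiction)
open import Relation.Nullary.Decidable using (⌊_⌋; True; toWitness; map′; decidable-stable; dec-true; isYes≗does; _×-dec_; _⊎-dec_; _→-dec_)

open Equivalence using (to; from)

private variable
  k l : ℕ

-- Adjacency matrices and lists of partial colourings.

BoolRel : ℕ → Set
BoolRel m = Fin m → Fin m → Bool

Row : ℕ → Set
Row = Vec Bool

Matrix : ℕ → Set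
Matrix k = Vec (Row k) k

entry : Matrix k → BoolRel k
entry M i j = lookup (lookup M i) j

extend : Row k → Matrix k → Matrix (suc k)
extend r M = (false ∷ r) ∷ zipWith _∷_ r M

disjoint : Row k → Row k → Bool
disjoint []          []          = true
disjoint (true ∷ r)  (true ∷ s)  = false
disjoint (true ∷ r)  (false ∷ s) = disjoint r s
disjoint (false ∷ r) (_ ∷ s)     = disjoint r s

none : Row k → Bool
none []          = true
none (true ∷ r)  = false
none (false ∷ r) = none r

atMostOne : Row k → Bool
atMostOne []          = true
atMostOne (true ∷ r)  = none r
atMostOne (false ∷ r) = atMostOne r

count : Row k → ℕ
count []          = 0
count (true ∷ r)  = suc (count r)
count (false ∷ r) = count r

-- Used with `s` equal to `r`, where it says that the set `r` is independent. The recursion consumes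
-- `s` along with the rows of `M`, while `r` has to stay whole.
independent : Row k → Row l → Vec (Row k) l → Bool
independent r []          []      = true
independent r (true ∷ s)  (x ∷ M) = disjoint r x ∧ independent r s M
independent r (false ∷ s) (x ∷ M) = independent r s M

_==_ : Bool → Bool → Bool
true  == b = b
false == b = not b

-- A 2-colouring, and the vertices that have a neighbour of their own colour.
State : ℕ → Set
State k = Row k × Row k

-- Colour `b` is allowed if at most one earlier neighbour (`same`) has it and that neighbour is not
-- yet marked in the state; both ends are then marked.
try : Bool → Row k → State k → List (State (suc k))
try b r (c , s) with zipWith (λ x y → x ∧ (y == b)) r c
... | same = if atMostOne same ∧ disjoint same s
             then List.[ b ∷ c , not (none same) ∷ zipWith _∨_ same s ]
             else []

extendAll : Row k → List (State k) → List (State (suc k))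
extendAll r []       = []
extendAll r (x ∷ xs) = try true r x List.++ try false r x List.++ extendAll r xs

-- Certificates of non-planarity.

module _ {m : ℕ} (A : BoolRel m) where
  Adjacent : Fin m → Fin m → Set
  Adjacent i j = T (A i j)

  nbrs : Fin m → List (Fin m)
  nbrs i = filter (λ j → T? (A i j)) (allFin m)

  degree : Fin m → ℕ
  degree i = length (nbrs i)

  arcs : List (Fin m × Fin m)
  arcs = filter (λ (i , j) → T? (A i j)) (cartesianProduct (allFin m) (allFin m))

  nonisolated : List (Fin m)
  nonisolated = filter (λ i → 1 ≤? degree i) (allFin m)

  -- Excludes components that are single edges, the source of faces of length two. Isolated vertices
  -- satisfy the second alternative vacuously.
  NoIsolatedEdge : Set
  NoIsolatedEdge = ∀ i → 2 ≤ degree i ⊎ (∀ j → Adjacent i j → 2 ≤ degree j)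

  -- Contradicts the Euler formula for a map whose faces have length at least 4
  -- and exceed 4 by at least s darts in total.
  Dense : ℕ → Set
  Dense s = 4 * length nonisolated < length arcs + (8 + s)

  -- The neighbourhood of z cuts that of v into two nonempty parts such that v is
  -- the only common neighbour of vertices from different parts.
  Separates : Fin m → Fin m → Set
  Separates z v = 3 ≤ degree v
    × (∃ λ x → Adjacent v x × Adjacent z x)
    × (∃ λ y → Adjacent v y × ¬ Adjacent z y)
    × (∀ x → Adjacent v x → Adjacent z x → ∀ y → Adjacent v y → ¬ Adjacent z y →
         ∀ w → Adjacent w x → Adjacent w y → w ≡ v)

  -- The face along the pendant edge passes `u`, `p` and `u` again; the degree bound at `u` keeps it
  -- from closing after four darts.
  Pendant : Fin m → Fin m → Set
  Pendant u p = Adjacent u p × degree p ≤ 1 × 3 ≤ degree u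

  -- `Dense 0` contradicts Euler's formula outright. `Dense 1` leaves no excess, so all faces are
  -- quadrangles; `Dense 3` leaves an excess of at most two, which the hexagon at the pendant edge
  -- uses up. In the last two cases consecutive neighbours of `v` have a second common neighbour,
  -- against `Separates`.
  Certificate : Set
  Certificate = NoIsolatedEdge
    × (Dense 0
      ⊎ (∃ λ v → (∃ λ z → Separates z v)
          × (Dense 1 ⊎ (Dense 3 × ∃ λ u → ¬ u ≡ v × ∃ λ p → Pendant u p))))

  adjacent? : ∀ i j → Dec (Adjacent i j)
  adjacent? i j = T? (A i j)

  separates? : ∀ z v → Dec (Separates z v)
  separates? z v = 3 ≤? degree v
    ×-dec Fin.any? (λ x → adjacent? v x ×-dec adjacent? z x)
    ×-dec Fin.any? (λ y → adjacent? v y ×-dec ¬? (adjacent? z y))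
    ×-dec Fin.all? (λ x → adjacent? v x →-dec (adjacent? z x →-dec Fin.all? (λ y → adjacent? v y →-dec (¬? (adjacent? z y)
       →-dec Fin.all? (λ w → adjacent? w x →-dec (adjacent? w y →-dec (w Fin.≟ v)))))))

  pendant? : ∀ u p → Dec (Pendant u p)
  pendant? u p = adjacent? u p ×-dec degree p ≤? 1 ×-dec 3 ≤? degree u

  dense? : ∀ s → Dec (Dense s)
  dense? s = 4 * length nonisolated <? length arcs + (8 + s)

  certificate? : Dec Certificate
  certificate? = Fin.all? (λ i → 2 ≤? degree i ⊎-dec Fin.all? λ j → adjacent? i j →-dec 2 ≤? degree j)
    ×-dec (dense? 0
      ⊎-dec Fin.any? λ v → Fin.any? (λ z → separates? z v)
          ×-dec (dense? 1 ⊎-dec (dense? 3 ×-dec Fin.any? λ u → ¬? (u Fin.≟ v) ×-dec Fin.any? λ p → pendant? u p)))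

-- Enumeration of the graphs of order 10 with a vertex of degree at least 4.

leaf : Matrix k → List (State k) → Bool
leaf M []       = ⌊ certificate? (entry M) ⌋
leaf M (_ ∷ _) = true

-- Adds n vertices adjacent to the fixed vertex and hence to none of the j already
-- added ones. Each is given by its row on the other l vertices, and rows are used
-- in the order of the list, so that every multiset is met only once.
searchNeighbours : ∀ (n : ℕ) → List (Row l) → (j : ℕ) → Matrix (j + l) → List (State (j + l)) → Bool
searchNeighbours zero    _        j M st = leaf M st
searchNeighbours (suc n) []       j M st = true
searchNeighbours (suc n) (S ∷ Ss) j M st =
  searchNeighbours n (S ∷ Ss) (suc j) (extend r M) (extendAll r st) ∧ searchNeighbours (suc n) Ss j M st
  where r = replicate j false ++ S

allRows : ∀ k → (Row k → Bool) → Bool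
allRows zero    P = P []
allRows (suc k) P = allRows k (λ r → P (true ∷ r)) ∧ allRows k (λ r → P (false ∷ r))

rows : ∀ k → List (Row k)
rows zero    = [] ∷ []
rows (suc k) = List.map (true ∷_) (rows k) List.++ List.map (false ∷_) (rows k)

flat : Vec (Row k) l → Bool
flat []      = true
flat (r ∷ M) = atMostOne r ∧ flat M

sorted : Vec (Row k) l → Bool
sorted []           = true
sorted (r ∷ [])     = true
sorted (r ∷ s ∷ M) = (count r ≤ᵇ count s) ∧ sorted (s ∷ M)

-- The leading `true` is adjacency to the fixed vertex, which comes first in the base. Two adjacent
-- vertices in the rest of the row would close a triangle.
candidates : Matrix k → List (Row (suc k))
candidates {k} M = List.map (true ∷_) (List.filterᵇ (λ r → independent r r M) (rows k))

-- Enumerates the graphs on the non-neighbours of the fixed vertex, which is then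
-- added with its Δ neighbours. Ordering by degree removes most of the isomorphic
-- copies; graphs of maximum degree at most one need no search (flat-twoColourable).
searchRest : (n : ℕ) → ℕ → Matrix k → List (State k) → Bool
searchRest {k} zero Δ M st =
  if flat M ∨ not (sorted M) then true
  else searchNeighbours Δ (candidates M) 0 (extend v M) (extendAll v st)
  where v = replicate k false
searchRest {k} (suc n) Δ M st =
  allRows k λ r → if independent r r M then searchRest n Δ (extend r M) (extendAll r st) else true

-- Here `n` counts the vertices other than the fixed one and its neighbours; in order 10 this leaves
-- `9 ∸ n` neighbours.
search : ℕ → Bool
search n = searchRest n (9 ∸ n) [] (([] , []) ∷ [])

-- The whole enumeration, by evaluation. The bound 5 corresponds to a fixed vertex of degree at
-- least 4.
search-≤5 : ∀ r → r ≤ 5 → search r ≡ true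
search-≤5 0 _ = refl
search-≤5 1 _ = refl
search-≤5 2 _ = refl
search-≤5 3 _ = refl
search-≤5 4 _ = refl
search-≤5 5 _ = refl
search-≤5 (suc (suc (suc (suc (suc (suc r)))))) (s≤s (s≤s (s≤s (s≤s (s≤s ())))))

-- Soundness of the Boolean tests and of colouring one more vertex.

lookup-none : ∀ (r : Row k) i → T (lookup r i) → ¬ T (none r)
lookup-none (true ∷ r)  i       p ()
lookup-none (false ∷ r) (suc i) p q = lookup-none r i p q

atMostOne-unique : ∀ (r : Row k) → T (atMostOne r) →
  ∀ i j → T (lookup r i) → T (lookup r j) → i ≡ j
atMostOne-unique (true ∷ r)  h zero    zero    p q = refl
atMostOne-unique (true ∷ r)  h zero    (suc j) p q = contradiction h (lookup-none r j q)
atMostOne-unique (true ∷ r)  h (suc i) j       p q = contradiction h (lookup-none r i p)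
atMostOne-unique (false ∷ r) h (suc i) (suc j) p q = cong suc (atMostOne-unique r h i j p q)

disjoint-lookup : ∀ (r s : Row k) → T (disjoint r s) →
  ∀ i → T (lookup r i) → ¬ T (lookup s i)
disjoint-lookup (true ∷ r)  (false ∷ s) h (suc i) p q = disjoint-lookup r s h i p q
disjoint-lookup (false ∷ r) (_ ∷ s)     h (suc i) p q = disjoint-lookup r s h i p q

==-refl : ∀ b → T (b == b)
==-refl true  = tt
==-refl false = tt

∈-rows : ∀ (r : Row k) → r ∈ rows k
∈-rows []                = here refl
∈-rows (true ∷ r)        = ∈-++⁺ˡ (∈-map⁺ (true ∷_) (∈-rows r))
∈-rows {suc k} (false ∷ r) = ∈-++⁺ʳ (List.map (true ∷_) (rows k)) (∈-map⁺ (false ∷_) (∈-rows r))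

allRows-sound : ∀ k (P : Row k → Bool) → T (allRows k P) → ∀ r → T (P r)
allRows-sound zero    P h []          = h
allRows-sound (suc k) P h (true ∷ r)  = allRows-sound k _ (proj₁ (to T-∧ h)) r
allRows-sound (suc k) P h (false ∷ r) = allRows-sound k _ (proj₂ (to (T-∧ {allRows k (λ r → P (true ∷ r))}) h)) r

-- The marks `s` are required in one direction only: an unmarked vertex has no neighbour of its own
-- colour and may still receive one. The second clause is the defect bound.
Valid : Matrix k → State k → Set
Valid M (c , s) =
    (∀ i j → T (entry M i j) → lookup c i ≡ lookup c j → T (lookup s i))
  × (∀ i j k → T (entry M i j) → T (entry M i k) →
       lookup c i ≡ lookup c j → lookup c i ≡ lookup c k → j ≡ k)

entry-zero : ∀ (r : Row k) (M : Vec (Row l) k) i → lookup (lookup (zipWith _∷_ r M) i) zero ≡ lookup r i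
entry-zero r M i = cong (λ x → lookup x zero) (lookup-zipWith _∷_ i r M)

entry-suc : ∀ (r : Row k) (M : Vec (Row l) k) i j →
  lookup (lookup (zipWith _∷_ r M) i) (suc j) ≡ lookup (lookup M i) j
entry-suc r M i j = cong (λ x → lookup x (suc j)) (lookup-zipWith _∷_ i r M)

module _ (b : Bool) (r : Row k) (M : Matrix k) (c s : Row k) where
  private
    same = zipWith (λ x y → x ∧ (y == b)) r c

    same⁺ : ∀ i → T (lookup r i) → lookup c i ≡ b → T (lookup same i)
    same⁺ i p q rewrite lookup-zipWith (λ x y → x ∧ (y == b)) i r c | q = from T-∧ (p , ==-refl b)

  colour-extend : T (atMostOne same) → T (disjoint same s) → Valid M (c , s) →
    Valid (extend r M) (b ∷ c , not (none same) ∷ zipWith _∨_ same s)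
  colour-extend one dis (sat , uni) = sat′ , uni′
    where
    sat′ : ∀ i j → T (entry (extend r M) i j) → lookup (b ∷ c) i ≡ lookup (b ∷ c) j →
           T (lookup (not (none same) ∷ zipWith _∨_ same s) i)
    sat′ zero    (suc j) p q = from Bool.T-not-≡ (Bool.¬-not λ e → lookup-none same j (same⁺ j p (sym q)) (from T-≡ e))
    sat′ (suc i) zero    p q rewrite lookup-zipWith _∨_ i same s =
      from Bool.T-∨ (inj₁ (same⁺ i (subst T (entry-zero r M i) p) q))
    sat′ (suc i) (suc j) p q rewrite lookup-zipWith _∨_ i same s =
      from (Bool.T-∨ {lookup same i}) (inj₂ (sat i j (subst T (entry-suc r M i j) p) q))

    uni′ : ∀ i j k → T (entry (extend r M) i j) → T (entry (extend r M) i k) →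
      lookup (b ∷ c) i ≡ lookup (b ∷ c) j → lookup (b ∷ c) i ≡ lookup (b ∷ c) k → j ≡ k
    -- An old vertex sharing its colour with both the new vertex and an old neighbour would be
    -- marked in `s`, but `same` is disjoint from `s`.
    clash : ∀ {X : Set} i j → T (entry (extend r M) (suc i) zero) → T (entry (extend r M) (suc i) (suc j)) →
      lookup c i ≡ b → lookup c i ≡ lookup c j → X
    clash i j p p′ q q′ = contradiction (sat i j (subst T (entry-suc r M i j) p′) q′)
      (disjoint-lookup same s dis i (same⁺ i (subst T (entry-zero r M i) p) q))
    uni′ zero    (suc j) (suc k) p p′ q q′ =
      cong suc (atMostOne-unique same one j k (same⁺ j p (sym q)) (same⁺ k p′ (sym q′)))
    uni′ (suc i) zero    zero    p p′ q q′ = refl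
    uni′ (suc i) zero    (suc k) p p′ q q′ = clash i k p p′ q q′
    uni′ (suc i) (suc j) zero    p p′ q q′ = clash i j p′ p q′ q
    uni′ (suc i) (suc j) (suc k) p p′ q q′ =
      cong suc (uni i j k (subst T (entry-suc r M i j) p) (subst T (entry-suc r M i k) p′) q q′)

  try-valid : Valid M (c , s) → All (Valid (extend r M)) (try b r (c , s))
  try-valid h with atMostOne same in e₁ | disjoint same s in e₂
  ... | true  | true  = colour-extend (from T-≡ e₁) (from T-≡ e₂) h ∷ []
  ... | true  | false = []
  ... | false | _     = []

extendAll-valid : ∀ (r : Row k) (M : Matrix k) st → All (Valid M) st → All (Valid (extend r M)) (extendAll r st)
extendAll-valid r M []             []       = []
extendAll-valid r M ((c , s) ∷ st) (h ∷ hs) =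
  All.++⁺ (try-valid true r M c s h) (All.++⁺ (try-valid false r M c s h) (extendAll-valid r M st hs))

-- Soundness of the enumeration for graphs on an arbitrary vertex type.

TwoColourable : {V : Set} → (V → V → Bool) → Set
TwoColourable {V} A = ∃ λ (c : V → Bool) → ∀ x y z → T (A x y) → T (A x z) → c x ≡ c y → c x ≡ c z → y ≡ z

position : ∀ {V : Set} {x : V} (L : Vec V k) → x ∈ toList L → ∃ λ i → lookup L i ≡ x
position L x∈L = VecAny.index x∈L′ , sym (lookup-index x∈L′)
  where x∈L′ = ∈-toList⁻ x∈L

lookup-∈ : ∀ {V : Set} (L : Vec V k) i → lookup L i ∈ toList L
lookup-∈ (x ∷ L) zero    = here refl
lookup-∈ (x ∷ L) (suc i) = there (lookup-∈ L i)

module Adjacency {V : Set} (A : V → V → Bool) where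

  row : V → Vec V k → Row k
  row u = map (A u)

  matrix : Vec V k → Matrix k
  matrix L = map (λ x → row x L) L

  entry-matrix : ∀ (L : Vec V k) i j → entry (matrix L) i j ≡ A (lookup L i) (lookup L j)
  entry-matrix L i j rewrite lookup-map i (λ x → row x L) L = lookup-map j (A (lookup L i)) L

  -- The search arranges the vertices in its own order, so the result refers to some ordering `L` of
  -- `xs`.
  Outcome : List V → Set
  Outcome xs = ∃₂ λ k (L : Vec V k) → toList L ↭ xs
    × (∃ (Valid (matrix L)) ⊎ Certificate (entry (matrix L)))

  Outcome-resp-↭ : ∀ {xs ys} → xs ↭ ys → Outcome xs → Outcome ys
  Outcome-resp-↭ p (k , L , q , r) = k , L , ↭-trans q p , r

  false-row : ∀ u (P : Vec V k) → (∀ i → A u (lookup P i) ≡ false) → row u P ≡ replicate k false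
  false-row u []      h = refl
  false-row u (x ∷ P) h = cong₂ _∷_ (h zero) (false-row u P (h ∘ suc))

  flat-row : ∀ (L : Vec V k) (K : Vec V l) → T (flat (map (λ x → row x L) K)) →
    ∀ i → T (atMostOne (row (lookup K i) L))
  flat-row L (x ∷ K) h zero    = proj₁ (to T-∧ h)
  flat-row L (x ∷ K) h (suc i) = flat-row L K (proj₂ (to (T-∧ {atMostOne (row x L)}) h)) i

  nbrsIn : List V → V → List V
  nbrsIn xs v = filter (λ x → T? (A v x)) xs

  othersIn : List V → V → List V
  othersIn xs v = filter (λ x → A v x Bool.≟ false) xs

  split-↭ : ∀ v xs → nbrsIn xs v List.++ othersIn xs v ↭ xs
  split-↭ v []       = ↭-refl
  split-↭ v (x ∷ xs) with A v x
  ... | true  = prep x (split-↭ v xs)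
  ... | false = ↭-trans (shift x (nbrsIn xs v) (othersIn xs v)) (prep x (split-↭ v xs))

  count-row : ∀ x (L : Vec V k) → count (row x L) ≡ length (nbrsIn (toList L) x)
  count-row x []      = refl
  count-row x (y ∷ L) with A x y
  ... | true  = cong suc (count-row x L)
  ... | false = count-row x L

  module _ (R : List V) where
    key : V → ℕ
    key x = length (nbrsIn R x)

    open Sort (On.decTotalOrder ℕ.≤-decTotalOrder key) using (sort; sort-↭; sort-↗)

    sortByDegree : List V
    sortByDegree = sort R

    sortByDegree-↭ : sortByDegree ↭ R
    sortByDegree-↭ = sort-↭ R

    sorted-rows : ∀ (L : Vec V k) → toList L ↭ R → (K : Vec V l) →
      Linked.Linked (λ x y → key x ≤ key y) (toList K) → T (sorted (map (λ x → row x L) K))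
    sorted-rows L p []           s = tt
    sorted-rows L p (x ∷ [])     s = tt
    sorted-rows L p (x ∷ y ∷ K) (x≤y ∷ s) = from T-∧ (ℕ.≤⇒≤ᵇ (subst₂ _≤_ (degree≡ x) (degree≡ y) x≤y) , sorted-rows L p (y ∷ K) s)
      where
      degree≡ : ∀ x → key x ≡ count (row x L)
      degree≡ x = sym (trans (count-row x L) (↭-length (filter-↭ _ p)))

    sorted-matrix : ∀ (L : Vec V k) → toList L ≡ sortByDegree → T (sorted (matrix L))
    sorted-matrix L eq = sorted-rows L (↭-trans (↭-reflexive eq) sortByDegree-↭) L (subst (Linked.Linked _) (sym eq) (sort-↗ R))

module _ {V : Set} (A : V → V → Bool)
  (A-sym : ∀ u v → A u v ≡ A v u) (A-irrefl : ∀ v → A v v ≡ false)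
  (A-triangleFree : ∀ u v w → T (A u v) → T (A v w) → A u w ≡ false) where
  open Adjacency A

  matrix-∷ : ∀ u (L : Vec V k) → matrix (u ∷ L) ≡ extend (row u L) (matrix L)
  matrix-∷ u L = cong₂ (λ b M → (b ∷ row u L) ∷ M) (A-irrefl u) (columns L)
    where
    columns : ∀ (K : Vec V l) → map (λ x → row x (u ∷ L)) K ≡ zipWith _∷_ (row u K) (map (λ x → row x L) K)
    columns []      = refl
    columns (x ∷ K) = cong₂ (λ b M → (b ∷ row x L) ∷ M) (A-sym x u) (columns K)

  module _ {v : V} (base : Vec V l) where

    extract : ∀ S xs → (∃₂ λ u ys → xs ↭ u ∷ ys × row u base ≡ S) ⊎ All (λ u → row u base ≢ S) xs
    extract S xs with Any.any? (λ u → ≡-dec Bool._≟_ (row u base) S) xs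
    ... | no ¬p = inj₂ (All.¬Any⇒All¬ xs ¬p)
    ... | yes p with u , u∈xs , e ← find p with ys , zs , refl ← ∈-∃++ u∈xs =
      inj₁ (u , ys List.++ zs , shift u ys zs , e)

    -- The entries at `P` vanish because an edge between two neighbours of `v` would close a
    -- triangle.
    matrix-neighbour : ∀ {S} u (P : Vec V k) → row u base ≡ S → T (A v u) → (∀ i → T (A v (lookup P i))) →
      matrix (u ∷ P ++ base) ≡ extend (replicate k false ++ S) (matrix (P ++ base))
    matrix-neighbour u P row≡ vu vP = trans (matrix-∷ u (P ++ base)) (cong (λ r → extend r (matrix (P ++ base)))
      (trans (map-++ (A u) P base)
        (cong₂ _++_ (false-row u P λ i → A-triangleFree u v _ (subst T (A-sym v u) vu) (vP i)) row≡)))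

    -- The search branches on using `S` or dropping it; the branch followed uses `S` as long as some
    -- remaining vertex has this row. When `S` is dropped, all remaining rows therefore lie in `Ss`.
    searchNeighbours-sound : ∀ n Ss {j} (P : Vec V j) st →
      T (searchNeighbours n Ss j (matrix (P ++ base)) st) → All (Valid (matrix (P ++ base))) st →
      (xs : List V) → length xs ≡ n → All (λ u → row u base ∈ Ss) xs →
      All (λ u → T (A v u)) xs → (∀ i → T (A v (lookup P i))) → Outcome (xs List.++ toList (P ++ base))
    searchNeighbours-sound zero Ss P [] h hst [] eq mem nb nbP = _ , P ++ base , ↭-refl , inj₂ (toWitness h)
    searchNeighbours-sound zero Ss P (x ∷ st) h (hx ∷ _) [] eq mem nb nbP = _ , P ++ base , ↭-refl , inj₁ (x , hx)
    searchNeighbours-sound (suc n) [] P st h hst (x ∷ xs) eq (() ∷ _) nb nbP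
    searchNeighbours-sound (suc n) (S ∷ Ss) {j} P st h hst xs eq mem nb nbP =
      [ (λ (u , ys , xs↭ , row≡) →
           let nb′ = All-resp-↭ xs↭ nb
               M≡  = matrix-neighbour u P row≡ (All.head nb′) nbP
           in Outcome-resp-↭ (↭-trans (shift u ys _) (++⁺ʳ _ (↭-sym xs↭)))
                (searchNeighbours-sound n (S ∷ Ss) (u ∷ P) _
                  (subst (λ M → T (searchNeighbours n (S ∷ Ss) (suc j) M (extendAll r st))) (sym M≡) (proj₁ both))
                  (subst (λ M → All (Valid M) (extendAll r st)) (sym M≡) (extendAll-valid r _ st hst))
                  ys (ℕ.suc-injective (trans (sym (↭-length xs↭)) eq))
                  (All.tail (All-resp-↭ xs↭ mem)) (All.tail nb′) λ { zero → All.head nb′ ; (suc i) → nbP i }))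
      , (λ ne → searchNeighbours-sound (suc n) Ss P st (proj₂ both) hst xs eq
           (All.zipWith (λ { (ne , here e) → contradiction e ne ; (ne , there m) → m }) (ne , mem)) nb nbP)
      ]′ (extract S xs)
      where
      r = replicate j false ++ S
      both = to (T-∧ {searchNeighbours n (S ∷ Ss) (suc j) (extend r (matrix (P ++ base))) (extendAll r st)}) h

  disjoint-row : ∀ x y → T (A x y) → (L : Vec V k) → disjoint (row x L) (row y L) ≡ true
  disjoint-row x y xy []      = refl
  disjoint-row x y xy (z ∷ L) with A x z in xz
  ... | false = disjoint-row x y xy L
  ... | true rewrite A-triangleFree y x z (subst T (A-sym x y) xy) (from T-≡ xz) = disjoint-row x y xy L

  independent-row : ∀ x (L : Vec V k) (K : Vec V l) →
    independent (row x L) (row x K) (map (λ y → row y L) K) ≡ true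
  independent-row x L []      = refl
  independent-row x L (y ∷ K) with A x y in xy
  ... | false = independent-row x L K
  ... | true rewrite disjoint-row x y (from T-≡ xy) L = independent-row x L K

  -- The actual row of each vertex selects one branch of the enumeration. New vertices go to the
  -- front, hence the reversed list.
  searchRest-reach : ∀ n Δ (L : Vec V k) st → T (searchRest n Δ (matrix L) st) → All (Valid (matrix L)) st →
    ∀ xs → length xs ≡ n → ∃₂ λ m (K : Vec V m) → ∃ λ st′ →
      toList K ≡ xs ʳ++ toList L × T (searchRest 0 Δ (matrix K) st′) × All (Valid (matrix K)) st′
  searchRest-reach zero    Δ L st h hst [] eq = _ , L , st , refl , h , hst
  searchRest-reach (suc n) Δ L st h hst (x ∷ xs) eq with allRows-sound _ _ h (row x L)
  ... | h′ rewrite independent-row x L L =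
    searchRest-reach n Δ (x ∷ L) _
      (subst (λ M → T (searchRest n Δ M (extendAll (row x L) st))) (sym (matrix-∷ x L)) h′)
      (subst (λ M → All (Valid M) (extendAll (row x L) st)) (sym (matrix-∷ x L)) (extendAll-valid _ _ st hst))
      xs (ℕ.suc-injective eq)

  -- One colour for the neighbours of v and one for all other vertices.
  flat-twoColourable : ∀ v (L : Vec V k) → T (flat (matrix L)) → (∀ i → A v (lookup L i) ≡ false) →
    (∀ x → A v x ≡ false → x ≡ v ⊎ x ∈ toList L) → TwoColourable A
  flat-twoColourable v L h vL cover = A v , unique
    where
    located : ∀ x y → T (A x y) → A v x ≡ false → A v y ≡ false → x ∈ toList L
    located x y xy vx vy with cover x vx
    ... | inj₂ m    = m
    ... | inj₁ refl = contradiction xy (subst (¬_ ∘ T) (sym vy) (λ ()))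
    unique : ∀ x y z → T (A x y) → T (A x z) → A v x ≡ A v y → A v x ≡ A v z → y ≡ z
    unique x y z xy xz p q with A v x in vx
    ... | true = contradiction xy (subst (¬_ ∘ T) (sym (A-triangleFree x v y (from T-≡ (trans (A-sym x v) vx)) (from T-≡ (sym p)))) (λ ()))
    ... | false with position L (located x y xy vx (sym p))
                   | position L (located y x (subst T (A-sym x y) xy) (sym p) vx)
                   | position L (located z x (subst T (A-sym x z) xz) (sym q) vx)
    ... | i , refl | j , refl | k , refl = cong (lookup L) (atMostOne-unique (row (lookup L i) L) (flat-row L L h i) j k
      (subst T (sym (lookup-map j _ L)) xy) (subst T (sym (lookup-map k _ L)) xz))

  valid-twoColourable : (L : Vec V k) → (∀ x → ∃ λ i → lookup L i ≡ x) → ∀ st → Valid (matrix L) st → TwoColourable A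
  valid-twoColourable L pos (c , s) (_ , uni) = (λ x → lookup c (proj₁ (pos x))) , unique
    where
    unique : ∀ x y z → T (A x y) → T (A x z) → lookup c (proj₁ (pos x)) ≡ lookup c (proj₁ (pos y)) →
      lookup c (proj₁ (pos x)) ≡ lookup c (proj₁ (pos z)) → y ≡ z
    unique x y z xy xz p q with pos x | pos y | pos z
    ... | i , refl | j , refl | k , refl = cong (lookup L) (uni i j k
      (subst T (sym (entry-matrix L i j)) xy) (subst T (sym (entry-matrix L i k)) xz) p q)

  outcome-twoColourable : ∀ {vs} → (∀ x → x ∈ vs) → Outcome vs →
    TwoColourable A ⊎ ∃₂ λ k (L : Vec V k) → toList L ↭ vs × Certificate (entry (matrix L))
  outcome-twoColourable complete (k , L , L↭vs , inj₂ cert)     = inj₂ (k , L , L↭vs , cert)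
  outcome-twoColourable complete (k , L , L↭vs , inj₁ (st , h)) =
    inj₁ (valid-twoColourable L (λ x → position L (∈-resp-↭ (↭-sym L↭vs) (complete x))) st h)

  searchNeighbours-start : ∀ v (K : Vec V k) st Δ →
    T (searchNeighbours Δ (candidates (matrix K)) 0
         (extend (replicate k false) (matrix K)) (extendAll (replicate k false) st)) →
    All (Valid (matrix K)) st → (∀ i → A v (lookup K i) ≡ false) →
    ∀ xs → length xs ≡ Δ → All (λ u → T (A v u)) xs → Outcome (xs List.++ v ∷ toList K)
  searchNeighbours-start {k} v K st Δ h hst vK xs eq nb =
    searchNeighbours-sound (v ∷ K) Δ (candidates (matrix K)) [] _ (subst (λ M → T (searchNeighbours Δ (candidates (matrix K)) 0 M (extendAll (replicate k false) st))) (sym M≡) h)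
      (subst (λ M → All (Valid M) (extendAll (replicate k false) st)) (sym M≡) (extendAll-valid _ _ st hst))
      xs eq (All.map candidate nb) nb λ ()
    where
    M≡ : matrix (v ∷ K) ≡ extend (replicate k false) (matrix K)
    M≡ = trans (matrix-∷ v K) (cong (λ r → extend r (matrix K)) (false-row v K vK))
    candidate : ∀ {u} → T (A v u) → row u (v ∷ K) ∈ candidates (matrix K)
    candidate {u} vu rewrite to T-≡ (subst T (A-sym v u) vu) =
      ∈-map⁺ (true ∷_) (∈-filter⁺ (T? ∘ _) (∈-rows (row u K)) (from T-≡ (independent-row u K K)))

  twoColourable-or-certificate : ∀ {vs} → (∀ x → x ∈ vs) → Unique vs → ∀ v r → search r ≡ true →
    suc (length (nbrsIn vs v) + r) ≡ 10 → length (othersIn vs v) ≡ suc r →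
    TwoColourable A ⊎ ∃₂ λ k (L : Vec V k) → toList L ↭ vs × Certificate (entry (matrix L))
  twoColourable-or-certificate {vs} complete uniq v r h eq eq′
    with ys , zs , split ← ∈-∃++ {xs = othersIn vs v} (∈-filter⁺ (λ x → A v x Bool.≟ false) (complete v) (A-irrefl v))
    = result
    where
    R = ys List.++ zs
    others↭ : othersIn vs v ↭ v ∷ R
    others↭ = ↭-trans (↭-reflexive split) (shift v ys zs)

    -- Reversed beforehand, since the search reverses it again: `K` is then sorted by degree.
    Rs = List.reverse (sortByDegree R)

    reach = searchRest-reach r (9 ∸ r) [] (([] , []) ∷ []) (from T-≡ h) (((λ ()) , (λ ())) ∷ []) Rs
      (trans (List.length-reverse (sortByDegree R)) (trans (↭-length (sortByDegree-↭ R)) (ℕ.suc-injective (trans (sym (↭-length others↭)) eq′))))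

    K : Vec V (proj₁ reach)
    K = proj₁ (proj₂ reach)
    st = proj₁ (proj₂ (proj₂ reach))

    K≡ : toList K ≡ sortByDegree R
    K≡ = trans (proj₁ (proj₂ (proj₂ (proj₂ reach)))) (List.reverse-involutive (sortByDegree R))
    K↭ : toList K ↭ R
    K↭ = ↭-trans (↭-reflexive K≡) (sortByDegree-↭ R)
    hK = proj₁ (proj₂ (proj₂ (proj₂ (proj₂ reach))))
    hst = proj₂ (proj₂ (proj₂ (proj₂ (proj₂ reach))))

    others-false : All (λ x → A v x ≡ false) (othersIn vs v)
    others-false = All.all-filter (λ x → A v x Bool.≟ false) vs

    vK : ∀ i → A v (lookup K i) ≡ false
    vK i = All.lookup (All.tail (All-resp-↭ others↭ others-false)) (∈-resp-↭ K↭ (lookup-∈ K i))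

    cover : ∀ x → A v x ≡ false → x ≡ v ⊎ x ∈ toList K
    cover x vx with ∈-resp-↭ others↭ (∈-filter⁺ (λ x → A v x Bool.≟ false) (complete x) vx)
    ... | here refl = inj₁ refl
    ... | there m   = inj₂ (∈-resp-↭ (↭-sym K↭) m)

    Δ≡ : length (nbrsIn vs v) ≡ 9 ∸ r
    Δ≡ = trans (sym (ℕ.m+n∸n≡m _ r)) (cong (_∸ r) (ℕ.suc-injective eq))

    finish : T (if flat (matrix K) ∨ not (sorted (matrix K)) then true else _) → _
    finish h with flat (matrix K) in flat≡ | sorted (matrix K) in sorted≡
    ... | true  | _     = inj₁ (flat-twoColourable v K (from T-≡ flat≡) vK cover)
    -- The search skips unsorted matrices, which cannot arise from the order chosen for `K`.
    ... | false | false = contradiction (sorted-matrix R K K≡) (subst (¬_ ∘ T) (sym sorted≡) λ ())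
    ... | false | true  = outcome-twoColourable complete (Outcome-resp-↭
          (↭-trans (++⁺ˡ (nbrsIn vs v) (↭-trans (prep v K↭) (↭-sym others↭))) (split-↭ v vs))
          (searchNeighbours-start v K st (9 ∸ r) h hst vK (nbrsIn vs v) Δ≡ (All.all-filter (λ x → T? (A v x)) vs)))

    result = finish hK

-- Counting along injective relations, and invariants of generated equivalences.

iterate : ∀ {A : Set} → (A → A) → ℕ → A → A
iterate f zero    x = x
iterate f (suc k) x = f (iterate f k x)

-- Each `x` removes a partner of its own from `ys`. With a relation in place of a function, the link
-- between the two may be an existential witness such as a dart.
pigeonhole : ∀ {A B : Set} (R : A → B → Set) → (∀ {x x′ y} → R x y → R x′ y → x ≡ x′) →
  ∀ {xs ys} → Unique xs → (∀ {x} → x ∈ xs → ∃ λ y → y ∈ ys × R x y) → length xs ≤ length ys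
pigeonhole R inj [] f = z≤n
pigeonhole {A} {B} R inj {x ∷ xs} {ys} (x∉ ∷ u) f
  with y , y∈ , rxy ← f (here refl)
  with as , bs , refl ← ∈-∃++ y∈
  rewrite ↭-length (shift y as bs) = s≤s (pigeonhole R inj u avoid)
  where
  avoid : ∀ {x′} → x′ ∈ xs → ∃ λ y′ → y′ ∈ as List.++ bs × R x′ y′
  avoid x′∈ with y′ , y′∈ , r ← f (there x′∈) with ∈-resp-↭ (shift y as bs) y′∈
  ... | here refl = contradiction (inj rxy r) (All.lookup x∉ x′∈)
  ... | there m   = y′ , m , r

unique⊆⇒length≤ : ∀ {A : Set} {xs ys : List A} → Unique xs → (∀ {x} → x ∈ xs → x ∈ ys) → length xs ≤ length ys
unique⊆⇒length≤ u f = pigeonhole _≡_ (λ p q → trans p (sym q)) u λ m → _ , f m , refl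

length-cartesianProductWith : ∀ {A B C : Set} (f : A → B → C) xs ys →
  length (cartesianProductWith f xs ys) ≡ length xs * length ys
length-cartesianProductWith f []       ys = refl
length-cartesianProductWith f (x ∷ xs) ys = trans (List.length-++ (List.map (f x) ys))
  (cong₂ _+_ (List.length-map (f x) ys) (length-cartesianProductWith f xs ys))

closure-invariant : ∀ {A : Set} {R : Rel A 0ℓ} (P : A → Set) →
  (∀ x y → R x y → P x → P y) → (∀ x y → R x y → P y → P x) →
  ∀ {x y} → EqClosure R x y → P x → P y
closure-invariant P fw bw r = proj₁ (EqClosure.fold
  {S = λ x y → (P x → P y) × (P y → P x)}
  (record { refl = id , id ; sym = λ (f , g) → g , f ; trans = λ (f , g) (h , k) → h ∘ f , g ∘ k })
  (λ r → fw _ _ r , bw _ _ r) r)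

-- Face lengths and Euler's formula on spherical maps.

-- The embedding of a plane graph with its vertices renamed; B is the adjacency
-- relation of the renamed graph and may have additional isolated vertices.
record SphericalMap {m : ℕ} (B : BoolRel m) : Set₁ where
  field
    D              : Set
    tail head      : D → Fin m
    rotate opposite : D → D
    adjacent       : ∀ d → T (B (tail d) (head d))
    dartOf         : ∀ {i j} → T (B i j) → ∃ λ d → tail d ≡ i × head d ≡ j
    dart-≡         : ∀ {d e} → tail d ≡ tail e → head d ≡ head e → d ≡ e
    rotate-injective : ∀ {d e} → rotate d ≡ rotate e → d ≡ e
    tail-opposite   : ∀ d → tail (opposite d) ≡ head d
    head-opposite   : ∀ d → head (opposite d) ≡ tail d
    cyclic         : ∀ d e → tail d ≡ tail e ⇔ EqClosure (Step rotate) d e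

  faceStep : D → D
  faceStep = rotate ∘ opposite

  Joined : Rel D 0ℓ
  Joined d e = rotate d ≡ e ⊎ opposite d ≡ e

  field
    {V E F C} : ℕ
    vertices   : ClassCount (Step rotate) V
    edges      : ClassCount (Step opposite) E
    faces      : ClassCount (Step faceStep) F
    components : ClassCount Joined C
    euler      : V + F ≡ E + 2 * C

-- Four times Euler's formula gives `2X + 8 ≤ 4N + 4F`. Bounding one copy of `X` below by `4F + s`
-- lets `4F` cancel.
euler-bound : ∀ {V E F C X s N} → V + F ≡ E + 2 * C → V ≤ N → F * 4 + s ≤ X → X ≤ E * 2 → 1 ≤ C → X + (8 + s) ≤ 4 * N
euler-bound {V} {E} {F} {C} {X} {s} {N} eu V≤N F≤X X≤E 1≤C = ℕ.+-cancelʳ-≤ (F * 4) _ _ (begin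
  X + (8 + s) + F * 4         ≡⟨ solve 3 (λ x s f → x :+ (con 8 :+ s) :+ f := (f :+ s) :+ (x :+ con 8)) refl X s (F * 4) ⟩
  (F * 4 + s) + (X + 8)       ≤⟨ ℕ.+-monoˡ-≤ (X + 8) F≤X ⟩
  X + (X + 8)                 ≤⟨ ℕ.+-mono-≤ X≤E (ℕ.+-mono-≤ X≤E (ℕ.*-monoʳ-≤ 8 1≤C)) ⟩
  E * 2 + (E * 2 + 8 * C)     ≡⟨ solve 2 (λ e c → e :* con 2 :+ (e :* con 2 :+ con 8 :* c) := con 4 :* (e :+ con 2 :* c)) refl E C ⟩
  4 * (E + 2 * C)             ≡⟨ cong (4 *_) eu ⟨
  4 * (V + F)                 ≡⟨ solve 2 (λ v f → con 4 :* (v :+ f) := con 4 :* v :+ f :* con 4) refl V F ⟩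
  4 * V + F * 4               ≤⟨ ℕ.+-monoˡ-≤ (F * 4) (ℕ.*-monoʳ-≤ 4 V≤N) ⟩
  4 * N + F * 4               ∎)
  where
  open ℕ.≤-Reasoning
  open +-*-Solver

module _ {m : ℕ} {B : BoolRel m} (S : SphericalMap B)
  (B-irrefl : ∀ v → ¬ T (B v v)) (B-triangleFree : ∀ u v w → T (B u v) → T (B v w) → ¬ T (B u w)) where
  open SphericalMap S renaming (faceStep to φ)

  _≟_ : (d e : D) → Dec (d ≡ e)
  d ≟ e = map′ (λ (p , q) → dart-≡ p q) (λ { refl → refl , refl }) (tail d Fin.≟ tail e ×-dec head d Fin.≟ head e)

  B-sym : ∀ {u v} → T (B u v) → T (B v u)
  B-sym uv with d , refl , refl ← dartOf uv =
    subst₂ (λ i j → T (B i j)) (tail-opposite d) (head-opposite d) (adjacent (opposite d))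

  opposite-involutive : ∀ d → opposite (opposite d) ≡ d
  opposite-involutive d = dart-≡ (trans (tail-opposite _) (head-opposite d)) (trans (head-opposite _) (tail-opposite d))

  opposite-≡ : ∀ {d e} → tail d ≡ head e → head d ≡ tail e → d ≡ opposite e
  opposite-≡ {d} {e} p q = dart-≡ (trans p (sym (tail-opposite e))) (trans q (sym (head-opposite e)))

  tail-rotate : ∀ d → tail (rotate d) ≡ tail d
  tail-rotate d = sym (from (cyclic d (rotate d)) (EqClosure.return refl))

  tail-φ : ∀ d → tail (φ d) ≡ head d
  tail-φ d = trans (tail-rotate (opposite d)) (tail-opposite d)

  φ-injective : ∀ {d e} → φ d ≡ φ e → d ≡ e
  φ-injective {d} {e} p = trans (sym (opposite-involutive d)) (trans (cong opposite (rotate-injective p)) (opposite-involutive e))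

  tail≢head : ∀ d → tail d ≢ head d
  tail≢head d p = B-irrefl (tail d) (subst (λ i → T (B (tail d) i)) (sym p) (adjacent d))

  φ^ : ℕ → D → D
  φ^ = iterate φ

  φ^-injective : ∀ k {d e} → φ^ k d ≡ φ^ k e → d ≡ e
  φ^-injective zero    p = p
  φ^-injective (suc k) p = φ^-injective k (φ-injective p)

  φ^-+ : ∀ j k d → φ^ (j + k) d ≡ φ^ j (φ^ k d)
  φ^-+ zero    k d = refl
  φ^-+ (suc j) k d = cong φ (φ^-+ j k d)

  -- A lower bound only: the face through `d` has length at least `ℓ`.
  ReturnsAfter : ℕ → D → Set
  ReturnsAfter ℓ d = ∀ k → 0 < k → k < ℓ → φ^ k d ≢ d

  distinct< : ∀ {ℓ d i j} → ReturnsAfter ℓ d → i < j → j < ℓ → φ^ i d ≢ φ^ j d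
  distinct< {ℓ} {d} {i} {j} h i<j j<ℓ p = h (j ∸ i) (ℕ.m<n⇒0<n∸m i<j) (ℕ.≤-<-trans (ℕ.m∸n≤m j i) j<ℓ)
    (sym (φ^-injective i (trans p (trans (cong (λ k → φ^ k d) (sym (ℕ.m+[n∸m]≡n (ℕ.<⇒≤ i<j)))) (φ^-+ i (j ∸ i) d)))))

  nbr∈ : ∀ {i j} → T (B i j) → j ∈ nbrs B i
  nbr∈ {i} {j} = ∈-filter⁺ (λ j → T? (B i j)) (∈-allFin j)

  nbrs-unique : ∀ i → Unique (nbrs B i)
  nbrs-unique i = Unique.filter⁺ (λ j → T? (B i j)) (Unique.allFin⁺ m)

  nbr∈⁻ : ∀ {i j} → j ∈ nbrs B i → T (B i j)
  nbr∈⁻ {i} = proj₂ ∘ ∈-filter⁻ (λ j → T? (B i j)) {xs = allFin m}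

  -- The rotation at a vertex is a single cycle, so a cycle through `d` and `e` alone exhausts the
  -- darts there.
  two-cycle : ∀ {d e} → rotate d ≡ e → rotate e ≡ d → ∀ x → tail x ≡ tail d → x ≡ d ⊎ x ≡ e
  two-cycle {d} {e} p q x t = closure-invariant (λ x → x ≡ d ⊎ x ≡ e) fw bw (to (cyclic d x) (sym t)) (inj₁ refl)
    where
    fw : ∀ x y → rotate x ≡ y → x ≡ d ⊎ x ≡ e → y ≡ d ⊎ y ≡ e
    fw x y r (inj₁ refl) = inj₂ (trans (sym r) p)
    fw x y r (inj₂ refl) = inj₁ (trans (sym r) q)
    bw : ∀ x y → rotate x ≡ y → y ≡ d ⊎ y ≡ e → x ≡ d ⊎ x ≡ e
    bw x y r (inj₁ refl) = inj₂ (rotate-injective (trans r (sym q)))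
    bw x y r (inj₂ refl) = inj₁ (rotate-injective (trans r (sym p)))

  two-cycle-degree : ∀ {d e} → rotate d ≡ e → rotate e ≡ d → degree B (tail d) ≤ 2
  two-cycle-degree {d} {e} p q = unique⊆⇒length≤ {ys = head d ∷ head e ∷ []} (nbrs-unique (tail d)) cover
    where
    cover : ∀ {j} → j ∈ nbrs B (tail d) → j ∈ head d ∷ head e ∷ []
    cover j∈ with x , t , refl ← dartOf (nbr∈⁻ j∈) with two-cycle p q x t
    ... | inj₁ refl = here refl
    ... | inj₂ refl = there (here refl)

  fixed-degree : ∀ {d} → rotate d ≡ d → degree B (tail d) ≤ 1
  fixed-degree {d} p = unique⊆⇒length≤ {ys = head d ∷ []} (nbrs-unique (tail d)) cover
    where
    cover : ∀ {j} → j ∈ nbrs B (tail d) → j ∈ head d ∷ []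
    cover j∈ with x , t , refl ← dartOf (nbr∈⁻ j∈) with two-cycle p p x t
    ... | inj₁ refl = here refl
    ... | inj₂ refl = here refl

  degree≤1-unique : ∀ {v a b} → degree B v ≤ 1 → T (B v a) → T (B v b) → a ≡ b
  degree≤1-unique {v} {a} {b} h va vb with a Fin.≟ b
  ... | yes p = p
  ... | no ¬p = contradiction (ℕ.≤-trans (unique⊆⇒length≤ {xs = a ∷ b ∷ []} ((¬p ∷ []) ∷ [] ∷ [])
          λ { (here refl) → nbr∈ va ; (there (here refl)) → nbr∈ vb }) h) λ { (s≤s ()) }

  module _ (noK₂ : NoIsolatedEdge B) where

    -- On a face of length two the rotation fixes both `d` and its opposite, so both ends have
    -- degree one and the edge is a component.
    φ²≢ : ∀ d → φ (φ d) ≢ d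
    φ²≢ d p = [ (λ h → contradiction (ℕ.≤-trans h (fixed-degree fix₂)) λ { (s≤s ()) })
              , (λ h → contradiction (ℕ.≤-trans (h (head d) (adjacent d))
                  (subst (λ i → degree B i ≤ 1) (tail-opposite d) (fixed-degree fix₁))) λ { (s≤s ()) })
              ]′ (noK₂ (tail d))
      where
      φd≡ : φ d ≡ opposite d
      φd≡ = opposite-≡ (tail-φ d) (trans (sym (tail-φ (φ d))) (cong tail p))
      fix₁ : rotate (opposite d) ≡ opposite d
      fix₁ = φd≡
      fix₂ : rotate d ≡ d
      fix₂ = trans (cong rotate (trans (sym (opposite-involutive d)) (cong opposite (sym φd≡)))) p

    -- Length one would be a loop, length two an isolated edge, length three a triangle.
    returnsAfter4 : ∀ d → ReturnsAfter 4 d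
    returnsAfter4 d (suc zero)          _ _ p = tail≢head d (trans (cong tail (sym p)) (tail-φ d))
    returnsAfter4 d (suc (suc zero))    _ _ p = φ²≢ d p
    returnsAfter4 d (suc (suc (suc zero))) _ _ p =
      B-triangleFree (tail d) (head d) (head (φ d)) (adjacent d)
        (subst (λ i → T (B i (head (φ d)))) (tail-φ d) (adjacent (φ d)))
        (B-sym (subst₂ (λ i j → T (B i j)) (tail-φ (φ d)) (trans (sym (tail-φ _)) (cong tail p)) (adjacent (φ (φ d)))))
    returnsAfter4 d (suc (suc (suc (suc k)))) _ (s≤s (s≤s (s≤s (s≤s ()))))

    face : D → Fin F
    face = Surjection.to (proj₁ faces)

    face-φ^ : ∀ k d → face (φ^ k d) ≡ face d
    face-φ^ zero    d = refl
    face-φ^ (suc k) d = trans (sym (from (proj₂ faces (φ^ k d) _) (EqClosure.return refl))) (face-φ^ k d)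

    Section : (Fin F → D) → Set
    Section s = ∀ i → face (s i) ≡ i

    -- A class of `opposite` consists of a dart and its reverse, and these are told apart by whether
    -- the tail is the smaller end.
    arcs-edges : length (arcs B) ≤ E * 2
    arcs-edges = subst (length (arcs B) ≤_)
      (trans (length-cartesianProductWith _,_ (allFin E) (allFin 2)) (cong₂ _*_ (List.length-tabulate {n = E} id) refl))
      (pigeonhole R inj {ys = cartesianProduct (allFin E) (allFin 2)} arcs-unique λ x∈ → let d , t , h = dartOf (proj₂ (∈-filter⁻ _ {xs = cartesianProduct (allFin m) (allFin m)} x∈)) in
        _ , ∈-cartesianProduct⁺ (∈-allFin _) (∈-allFin _) , d , t , h , refl , refl)
      where
      edge = Surjection.to (proj₁ edges)
      side : Fin m → Fin m → Fin 2
      side i j with i Fin.<? j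
      ... | yes _ = zero
      ... | no  _ = suc zero
      side-flip : ∀ {i j} → i ≢ j → side j i ≢ side i j
      side-flip {i} {j} i≢j with i Fin.<? j | j Fin.<? i
      ... | yes p | yes q = contradiction (ℕ.<-trans p q) (ℕ.<-irrefl refl)
      ... | yes p | no  q = λ ()
      ... | no  p | yes q = λ ()
      ... | no  p | no  q = contradiction (Fin.≤-antisym (ℕ.≮⇒≥ q) (ℕ.≮⇒≥ p)) i≢j
      direction : D → Fin 2
      direction d = side (tail d) (head d)
      direction-opposite : ∀ d → direction (opposite d) ≢ direction d
      direction-opposite d p = side-flip (tail≢head d) (trans (cong₂ side (sym (tail-opposite d)) (sym (head-opposite d))) p)
      R : Fin m × Fin m → Fin E × Fin 2 → Set
      R (i , j) (e , b) = ∃ λ d → tail d ≡ i × head d ≡ j × edge d ≡ e × direction d ≡ b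
      same-edge : ∀ {d e} → edge d ≡ edge e → e ≡ d ⊎ e ≡ opposite d
      same-edge {d} {e} p = closure-invariant (λ e → e ≡ d ⊎ e ≡ opposite d)
        (λ { x y r (inj₁ refl) → inj₂ (sym r) ; x y r (inj₂ refl) → inj₁ (trans (sym r) (opposite-involutive d)) })
        (λ { x y r (inj₁ refl) → inj₂ (trans (sym (opposite-involutive x)) (cong opposite r))
           ; x y r (inj₂ refl) → inj₁ (trans (sym (opposite-involutive x)) (trans (cong opposite r) (opposite-involutive d))) })
        (to (proj₂ edges d e) p) (inj₁ refl)
      inj : ∀ {x x′ y} → R x y → R x′ y → x ≡ x′
      inj (d , refl , refl , p , q) (e , refl , refl , p′ , q′) with same-edge (trans p (sym p′))
      ... | inj₁ refl = refl
      ... | inj₂ refl = contradiction (trans q′ (sym q)) (direction-opposite d)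
      arcs-unique : Unique (arcs B)
      arcs-unique = Unique.filter⁺ _ (Unique.cartesianProduct⁺ (Unique.allFin⁺ m) (Unique.allFin⁺ m))

    vertices-nonisolated : V ≤ length (nonisolated B)
    vertices-nonisolated = subst (_≤ length (nonisolated B)) (List.length-tabulate {n = V} id)
      (pigeonhole (λ i v → ∃ λ d → vertex d ≡ i × tail d ≡ v)
        (λ { (d , refl , p) (e , refl , q) → from (proj₂ vertices d e) (to (cyclic d e) (trans p (sym q))) })
        (Unique.allFin⁺ V)
        λ {i} _ → let d = Surjection.to⁻ (proj₁ vertices) i in
          tail d , ∈-filter⁺ _ (∈-allFin _) (ℕ.≤-trans (s≤s z≤n) (unique⊆⇒length≤ {xs = head d ∷ []} ([] ∷ []) λ { (here refl) → nbr∈ (adjacent d) }))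
            , d , Surjection.to∘to⁻ (proj₁ vertices) i , refl)
      where vertex = Surjection.to (proj₁ vertices)

    -- Every face contributes four darts, starting from its section; es are others.
    slack : ∀ s → Section s → ∀ es → Unique es → (∀ {e} → e ∈ es → ∀ k → k < 4 → φ^ k (s (face e)) ≢ e) →
      D → ¬ Dense B (length es)
    slack s sec es es! fresh d dense = ℕ.<-irrefl refl (ℕ.<-≤-trans dense
      (euler-bound {E = E} euler vertices-nonisolated F≤X arcs-edges 1≤C))
      where
      -- The given dart `d` belongs to some component.
      1≤C : 1 ≤ C
      1≤C = ℕ.≤-trans (s≤s z≤n) (Fin.toℕ<n (Surjection.to (proj₁ components) d))
      first4 : Fin F → Fin 4 → D
      first4 i k = φ^ (toℕ k) (s i)
      base = cartesianProductWith first4 (allFin F) (allFin 4)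
      face-first4 : ∀ i k → face (first4 i k) ≡ i
      face-first4 i k = trans (face-φ^ (toℕ k) (s i)) (sec i)
      first4-injective : ∀ {i j k l} → first4 i k ≡ first4 j l → i ≡ j × k ≡ l
      first4-injective {i} {j} {k} {l} p with trans (sym (face-first4 i k)) (trans (cong face p) (face-first4 j l))
      ... | refl with ℕ.<-cmp (toℕ k) (toℕ l)
      ... | tri≈ _ q _ = refl , Fin.toℕ-injective q
      ... | tri< q _ _ = contradiction p (distinct< (returnsAfter4 (s i)) q (Fin.toℕ<n l))
      ... | tri> _ _ q = contradiction (sym p) (distinct< (returnsAfter4 (s i)) q (Fin.toℕ<n k))
      base! : Unique base
      base! = Unique.cartesianProductWith⁺ first4 first4-injective (Unique.allFin⁺ F) (Unique.allFin⁺ 4)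
      disj : ∀ {e} → ¬ (e ∈ base × e ∈ es)
      disj (e∈ , e∈′) with i , k , _ , _ , refl ← ∈-cartesianProductWith⁻ first4 (allFin F) (allFin 4) e∈ =
        fresh e∈′ (toℕ k) (Fin.toℕ<n k) (cong (λ i → φ^ (toℕ k) (s i)) (face-first4 i k))
      F≤X : F * 4 + length es ≤ length (arcs B)
      F≤X = subst (_≤ length (arcs B))
        (trans (List.length-++ base) (cong (_+ length es)
          (trans (length-cartesianProductWith first4 (allFin F) (allFin 4)) (cong (_* 4) (List.length-tabulate {n = F} id)))))
        (pigeonhole (λ d a → tail d ≡ proj₁ a × head d ≡ proj₂ a)
          (λ (p , q) (p′ , q′) → dart-≡ (trans p (sym p′)) (trans q (sym q′)))
          (Unique.++⁺ base! es! disj)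
          λ {d} _ → (tail d , head d) , ∈-filter⁺ _ (∈-cartesianProduct⁺ (∈-allFin _) (∈-allFin _)) (adjacent d) , refl , refl)

    section : Fin F → D
    section = Surjection.to⁻ (proj₁ faces)

    section-face : Section section
    section-face = Surjection.to∘to⁻ (proj₁ faces)

    -- Makes `d` the representative of its own face, so that the four darts counted there are the
    -- first four from `d`.
    through : D → (Fin F → D) → Fin F → D
    through d s i with face d Fin.≟ i
    ... | yes _ = d
    ... | no  _ = s i

    through-section : ∀ d {s} → Section s → Section (through d s)
    through-section d h i with face d Fin.≟ i
    ... | yes p = p
    ... | no  _ = h i

    through-same : ∀ {d s i} → face d ≡ i → through d s i ≡ d
    through-same {d} {s} {i} p with face d Fin.≟ i
    ... | yes _ = refl
    ... | no ¬p = contradiction p ¬p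

    through-other : ∀ {d s i} → face d ≢ i → through d s i ≡ s i
    through-other {d} {s} {i} ¬p with face d Fin.≟ i
    ... | yes p = contradiction p ¬p
    ... | no _  = refl

    φ⁴≢-fresh : ∀ {d} → φ^ 4 d ≢ d → ReturnsAfter 5 d
    φ⁴≢-fresh {d} h k 0<k k<5 with ℕ.m≤n⇒m<n∨m≡n (ℕ.≤-pred k<5)
    ... | inj₁ k<4  = returnsAfter4 d k 0<k k<4
    ... | inj₂ refl = h

    -- Otherwise the fifth dart of the face is one in excess of the four counted.
    quadrangular : Dense B 1 → ∀ d → φ^ 4 d ≡ d
    quadrangular dense d = decidable-stable (φ^ 4 d ≟ d) λ h →
      slack (through d section) (through-section d section-face) (φ^ 4 d ∷ []) ([] ∷ [])
        (λ { (here refl) k k<4 p → distinct< {d = d} (φ⁴≢-fresh h) k<4 (ℕ.n<1+n 4)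
               (trans (cong (φ^ k) (sym (through-same {d} (sym (face-φ^ 4 d))))) p) })
        d dense

    -- The tail of d and the head of φ d are consecutive in the rotation at v.
    CoNeighbours : Fin m → Set
    CoNeighbours v = ∀ d → head d ≡ v → ∃ λ w → w ≢ v × T (B w (tail d)) × T (B w (head (φ d)))

    -- Adjacency to `z` passes between consecutive neighbours of `v`, since they have a common
    -- neighbour other than `v`. Around the cycle it reaches all neighbours, including `y`.
    no-separation : ∀ {z v} → Separates B z v → ¬ CoNeighbours v
    no-separation {z} {v} (_ , (x , vx , zx) , (y , vy , ¬zy) , sep) co
      with dx , refl , refl ← dartOf vx with dy , ty , refl ← dartOf vy =
      ¬zy (proj₂ (closure-invariant Inside fw bw (to (cyclic dx dy) (sym ty)) (refl , zx)))
      where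
      v′ = tail dx
      Inside : D → Set
      Inside d = tail d ≡ v′ × T (B z (head d))
      common : ∀ d → tail d ≡ v′ → ∃ λ w → w ≢ v′ × T (B w (head d)) × T (B w (head (rotate d)))
      common d t with w , w≢ , p , q ← co (opposite d) (trans (head-opposite d) t) =
        w , w≢ , subst (λ i → T (B w i)) (tail-opposite d) p , subst (λ e → T (B w (head (rotate e)))) (opposite-involutive d) q
      nbr : ∀ d → tail d ≡ v′ → T (B v′ (head d))
      nbr d t = subst (λ i → T (B i (head d))) t (adjacent d)
      fw : ∀ d e → rotate d ≡ e → Inside d → Inside e
      fw d e refl (t , p) = trans (tail-rotate d) t , decidable-stable (T? _) λ ¬p →
        let w , w≢ , q , r = common d t in
        w≢ (sep _ (nbr d t) p _ (nbr _ (trans (tail-rotate d) t)) ¬p w q r)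
      bw : ∀ d e → rotate d ≡ e → Inside e → Inside d
      bw d e refl (t′ , p) = t , decidable-stable (T? _) λ ¬p →
        let w , w≢ , q , r = common d t in
        w≢ (sep _ (nbr _ t′) p _ (nbr d t) ¬p w r q)
        where t = trans (sym (tail-rotate d)) t′

    φ-adjacent : ∀ d → T (B (head d) (head (φ d)))
    φ-adjacent d = subst (λ i → T (B i (head (φ d)))) (tail-φ d) (adjacent (φ d))

    -- A face that turns back at the end of φ d has a rotation cycle of length two at the head of d.
    no-spike : ∀ d → 3 ≤ degree B (head d) → head (φ^ 3 d) ≡ tail d → head (φ^ 2 d) ≢ head d
    no-spike d deg back p = contradiction
      (ℕ.≤-trans deg (subst (λ i → degree B i ≤ 2) (tail-φ d) (two-cycle-degree {φ d} {opposite d} rot refl)))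
      λ { (s≤s (s≤s ())) }
      where
      spike : φ^ 2 d ≡ opposite (φ d)
      spike = opposite-≡ (tail-φ (φ d)) (trans p (sym (tail-φ d)))
      rot : rotate (φ d) ≡ opposite d
      rot = trans (cong rotate (trans (sym (opposite-involutive (φ d))) (cong opposite (sym spike))))
        (opposite-≡ (trans (tail-φ (φ^ 2 d)) p) back)

    -- The fourth corner of the quadrangle is the second common neighbour; `no-spike` keeps it apart
    -- from the head of `d`.
    coneighbour : ∀ d → 3 ≤ degree B (head d) → head (φ^ 3 d) ≡ tail d →
      ∃ λ w → w ≢ head d × T (B w (tail d)) × T (B w (head (φ d)))
    coneighbour d deg back = head (φ^ 2 d) , no-spike d deg back
      , subst (λ i → T (B (head (φ^ 2 d)) i)) back (φ-adjacent (φ^ 2 d)) , B-sym (φ-adjacent (φ d))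

    head-φ : ∀ {d e} → φ d ≡ e → head d ≡ tail e
    head-φ {d} refl = sym (tail-φ d)

    quadrangular-coneighbours : ∀ {v} → 3 ≤ degree B v → (∀ d → φ^ 4 d ≡ d) → CoNeighbours v
    quadrangular-coneighbours deg quad d refl = coneighbour d deg (head-φ (quad d))

    module _ {u p : Fin m} (pend : Pendant B u p) (dense : Dense B 3) where
      private
        deg-p = proj₁ (proj₂ pend)
        deg-u = proj₂ (proj₂ pend)
        d₀ = proj₁ (dartOf (proj₁ pend))
        tail-d₀ : tail d₀ ≡ u
        tail-d₀ = proj₁ (proj₂ (dartOf (proj₁ pend)))
        head-d₀ : head d₀ ≡ p
        head-d₀ = proj₂ (proj₂ (dartOf (proj₁ pend)))

        φd₀ : φ d₀ ≡ opposite d₀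
        φd₀ = opposite-≡ (tail-φ d₀) (degree≤1-unique (subst (λ i → degree B i ≤ 1) (sym head-d₀) deg-p)
          (φ-adjacent d₀) (B-sym (adjacent d₀)))

        tail-φ² : tail (φ^ 2 d₀) ≡ tail d₀
        tail-φ² = trans (tail-φ (φ d₀)) (trans (cong head φd₀) (head-opposite d₀))

        φ²d₀ : rotate d₀ ≡ φ^ 2 d₀
        φ²d₀ = trans (cong rotate (sym (opposite-involutive d₀))) (cong φ (sym φd₀))

        -- Closing after four darts would make the rotation at `u` a two-cycle; closing after five
        -- would leave a triangle beyond the pendant edge.
        returns : ReturnsAfter 6 d₀
        returns 4 _ _ h = contradiction (ℕ.≤-trans deg-u
            (subst (λ i → degree B i ≤ 2) (trans (tail-φ²) tail-d₀) (two-cycle-degree {φ^ 2 d₀} rot φ²d₀)))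
            λ { (s≤s (s≤s ())) }
          where
          a₃ : φ^ 3 d₀ ≡ opposite (φ^ 2 d₀)
          a₃ = opposite-≡ (tail-φ (φ^ 2 d₀)) (trans (head-φ h) (sym tail-φ²))
          rot : rotate (φ^ 2 d₀) ≡ d₀
          rot = trans (cong rotate (trans (sym (opposite-involutive _)) (cong opposite (sym a₃)))) h
        returns 5 _ _ h = B-triangleFree _ _ _ (adjacent (φ^ 2 d₀)) (φ-adjacent (φ^ 2 d₀))
          (B-sym (subst (λ i → T (B (head (φ^ 3 d₀)) i)) (trans (head-φ h) (sym tail-φ²)) (φ-adjacent (φ^ 3 d₀))))
        returns 1 0< _ = returnsAfter4 d₀ 1 0< (s≤s (s≤s z≤n))
        returns 2 0< _ = returnsAfter4 d₀ 2 0< (s≤s (s≤s (s≤s z≤n)))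
        returns 3 0< _ = returnsAfter4 d₀ 3 0< (s≤s (s≤s (s≤s (s≤s z≤n))))
        returns (suc (suc (suc (suc (suc (suc k)))))) _ (s≤s (s≤s (s≤s (s≤s (s≤s (s≤s ()))))))

        -- Otherwise the fifth, sixth and seventh darts from `d₀` are three in excess, which
        -- `Dense B 3` forbids.
        hexagonal : φ^ 6 d₀ ≡ d₀
        hexagonal = decidable-stable (φ^ 6 d₀ ≟ d₀) λ h →
          let returns′ : ReturnsAfter 7 d₀
              returns′ k 0<k k<7 = [ returns k 0<k , (λ { refl → h }) ]′ (ℕ.m≤n⇒m<n∨m≡n (ℕ.≤-pred k<7))
              fresh : ∀ j → 4 ≤ j → j < 7 → ∀ k → k < 4 → φ^ k (through d₀ section (face (φ^ j d₀))) ≢ φ^ j d₀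
              fresh j 4≤j j<7 k k<4 eq = distinct< {d = d₀} returns′ (ℕ.<-≤-trans k<4 4≤j) j<7
                (trans (cong (φ^ k) (sym (through-same {d₀} (sym (face-φ^ j d₀))))) eq)
          in slack (through d₀ section) (through-section d₀ section-face) (φ^ 4 d₀ ∷ φ^ 5 d₀ ∷ φ^ 6 d₀ ∷ [])
            ((distinct< {d = d₀} returns′ (ℕ.n<1+n 4) 5<7 ∷ distinct< {d = d₀} returns′ (ℕ.m<n⇒m<1+n (ℕ.n<1+n 4)) 6<7 ∷ [])
              ∷ (distinct< {d = d₀} returns′ (ℕ.n<1+n 5) 6<7 ∷ []) ∷ [] ∷ [])
            (λ { (here refl) → fresh 4 ℕ.≤-refl (ℕ.m<n⇒m<1+n 5≤6)
               ; (there (here refl)) → fresh 5 (ℕ.n≤1+n 4) 5<7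
               ; (there (there (here refl))) → fresh 6 (ℕ.m≤n⇒m≤1+n (ℕ.n≤1+n 4)) 6<7 })
            d₀ dense
          where
          5≤6 : 5 ≤ 6
          5≤6 = ℕ.n≤1+n 5
          5<7 : 5 < 7
          5<7 = ℕ.n≤1+n 6
          6<7 : 6 < 7
          6<7 = ℕ.≤-refl

        -- The hexagon already has two darts in excess; a fifth dart on the face of `d` would be the
        -- third.
        quadrangular-elsewhere : ∀ d → face d₀ ≢ face d → φ^ 4 d ≡ d
        quadrangular-elsewhere d off = decidable-stable (φ^ 4 d ≟ d) λ h →
          slack (through d₀ (through d section)) (through-section d₀ (through-section d section-face))
            (φ^ 4 d₀ ∷ φ^ 5 d₀ ∷ φ^ 4 d ∷ [])
            ((distinct< {d = d₀} returns (ℕ.n<1+n 4) ℕ.≤-refl ∷ other 4 ∷ []) ∷ (other 5 ∷ []) ∷ [] ∷ [])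
            (λ { (here refl) → fresh 4 ℕ.≤-refl (ℕ.n≤1+n 5)
               ; (there (here refl)) → fresh 5 (ℕ.n≤1+n 4) ℕ.≤-refl
               ; (there (there (here refl))) k k<4 eq → distinct< {d = d} (φ⁴≢-fresh h) k<4 (ℕ.n<1+n 4)
                   (trans (cong (φ^ k) (sym (trans (through-other {d₀} (λ q → off (trans q (face-φ^ 4 d)))) (through-same {d} (sym (face-φ^ 4 d)))))) eq) })
            d₀ dense
          where
          other : ∀ k → φ^ k d₀ ≢ φ^ 4 d
          other k eq = off (trans (sym (face-φ^ k d₀)) (trans (cong face eq) (face-φ^ 4 d)))
          fresh : ∀ j → 4 ≤ j → j < 6 → ∀ k → k < 4 → φ^ k (through d₀ (through d section) (face (φ^ j d₀))) ≢ φ^ j d₀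
          fresh j 4≤j j<6 k k<4 eq = distinct< {d = d₀} returns (ℕ.<-≤-trans k<4 4≤j) j<6
            (trans (cong (φ^ k) (sym (through-same {d₀} (sym (face-φ^ j d₀))))) eq)

        on-hexagon : ∀ d → face d₀ ≡ face d → ∃ λ k → k < 6 × φ^ k d₀ ≡ d
        on-hexagon d eq = closure-invariant (λ d → ∃ λ k → k < 6 × φ^ k d₀ ≡ d) fw bw (to (proj₂ faces d₀ d) eq) (0 , s≤s z≤n , refl)
          where
          fw : ∀ x y → φ x ≡ y → (∃ λ k → k < 6 × φ^ k d₀ ≡ x) → ∃ λ k → k < 6 × φ^ k d₀ ≡ y
          fw x y refl (k , k<6 , refl) with ℕ.m≤n⇒m<n∨m≡n k<6
          ... | inj₁ h    = suc k , h , refl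
          ... | inj₂ refl = 0 , s≤s z≤n , sym hexagonal
          bw : ∀ x y → φ x ≡ y → (∃ λ k → k < 6 × φ^ k d₀ ≡ y) → ∃ λ k → k < 6 × φ^ k d₀ ≡ x
          bw x y p (zero  , k<6 , q) = 5 , ℕ.≤-refl , φ-injective (trans hexagonal (trans q (sym p)))
          bw x y p (suc k , k<6 , q) = k , ℕ.<-trans (ℕ.n<1+n k) k<6 , φ-injective (trans q (sym p))

      -- On the hexagon, darts 2 to 5 form a closed walk of length four through `u` and serve as a
      -- quadrangle. Dart 0 ends at `p`, of degree one; darts 1 and 5 end at `u`.
      pendant-coneighbours : ∀ {v} → u ≢ v → 3 ≤ degree B v → CoNeighbours v
      pendant-coneighbours {v} u≢v deg d refl with face d₀ Fin.≟ face d
      ... | no off = coneighbour d deg (head-φ (quadrangular-elsewhere d off))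
      ... | yes on with on-hexagon d on
      ... | 0 , _ , refl = contradiction (ℕ.≤-trans deg (subst (λ i → degree B i ≤ 1) (sym head-d₀) deg-p)) λ { (s≤s ()) }
      ... | 1 , _ , refl = contradiction (trans (sym tail-d₀) (sym (trans (cong head φd₀) (head-opposite d₀)))) u≢v
      ... | 2 , _ , refl = coneighbour (φ^ 2 d₀) deg (trans (head-φ hexagonal) (sym tail-φ²))
      ... | 3 , _ , refl = u , u≢v
        , subst₂ (λ i j → T (B i j)) (trans tail-φ² tail-d₀) (sym (tail-φ (φ^ 2 d₀))) (adjacent (φ^ 2 d₀))
        , B-sym (subst (λ i → T (B (head (φ^ 4 d₀)) i)) (trans (head-φ hexagonal) tail-d₀) (φ-adjacent (φ^ 4 d₀)))
      ... | 4 , _ , refl = head (φ^ 2 d₀) , spike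
        , subst (λ i → T (B (head (φ^ 2 d₀)) i)) (sym (tail-φ (φ^ 3 d₀))) (φ-adjacent (φ^ 2 d₀))
        , subst (λ i → T (B (head (φ^ 2 d₀)) i)) (trans tail-φ² (sym (head-φ hexagonal))) (B-sym (adjacent (φ^ 2 d₀)))
        where
        spike : head (φ^ 2 d₀) ≢ head (φ^ 4 d₀)
        spike eq = no-spike (φ^ 2 d₀) (subst (λ i → 3 ≤ degree B i) (sym eq) deg) (trans (head-φ hexagonal) (sym tail-φ²)) (sym eq)
      ... | 5 , _ , refl = contradiction (sym (trans (head-φ hexagonal) tail-d₀)) u≢v
      ... | suc (suc (suc (suc (suc (suc k))))) , s≤s (s≤s (s≤s (s≤s (s≤s (s≤s ()))))) , _

  no-certificate : D → ¬ Certificate B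
  no-certificate d (noK₂ , inj₁ dense) = slack noK₂ (section noK₂) (section-face noK₂) [] [] (λ ()) d dense
  no-certificate d (noK₂ , inj₂ (v , (z , sep@(deg , _)) , inj₁ dense)) =
    no-separation noK₂ sep (quadrangular-coneighbours noK₂ deg (quadrangular noK₂ dense))
  no-certificate d (noK₂ , inj₂ (v , (z , sep@(deg , _)) , inj₂ (dense , u , u≢v , p , pend))) =
    no-separation noK₂ sep (pendant-coneighbours noK₂ pend dense u≢v deg)

-- Lovász's recolouring argument for maximum degree 3.

open Sum ℕ.+-0-commutativeMonoid using (sum; sum-remove; sum-cong-≗; ∑-distrib-+)

indicator : Bool → ℕ
indicator b = if b then 1 else 0

length-filter≡sum : ∀ {n} {V : Set} (P : V → Bool) (f : Fin n → V) →
  length (filter (T? ∘ P) (List.tabulate f)) ≡ sum (indicator ∘ P ∘ f)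
length-filter≡sum {zero}  P f = refl
length-filter≡sum {suc n} P f with P (f zero)
... | true  = cong suc (length-filter≡sum P (f ∘ suc))
... | false = length-filter≡sum P (f ∘ suc)

module _ {n : ℕ} (A : Fin (suc n) → Fin (suc n) → Bool)
  (A-sym : ∀ u v → A u v ≡ A v u) (A-irrefl : ∀ v → A v v ≡ false)
  (degree≤3 : ∀ v → length (filter (λ x → T? (A v x)) (allFin (suc n))) ≤ 3) where
  private
    Colouring = Fin (suc n) → Bool

    same : Colouring → Fin (suc n) → Fin (suc n) → Bool
    same c u w = A u w ∧ (c u == c w)

    mono : Colouring → ℕ
    mono c = sum λ u → sum λ w → indicator (same c u w)

    at : Colouring → Fin (suc n) → ℕ
    at c v = sum λ w → indicator (same c v (punchIn v w))

    away : Colouring → Fin (suc n) → ℕ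
    away c v = sum λ u → sum λ w → indicator (same c (punchIn v u) (punchIn v w))

    ==-sym : ∀ a b → a == b ≡ b == a
    ==-sym true  true  = refl
    ==-sym true  false = refl
    ==-sym false true  = refl
    ==-sym false false = refl

    same-sym : ∀ c u w → same c u w ≡ same c w u
    same-sym c u w = cong₂ _∧_ (A-sym u w) (==-sym (c u) (c w))

    row : ∀ c v → sum (λ w → indicator (same c v w)) ≡ at c v
    row c v = trans (sum-remove {i = v} (λ w → indicator (same c v w)))
      (cong (_+ at c v) (cong (λ b → indicator (b ∧ (c v == c v))) (A-irrefl v)))

    -- Ordered pairs are counted, so the monochromatic edges at `v` appear once in its row and once
    -- in its column.
    mono-split : ∀ c v → mono c ≡ at c v + (at c v + away c v)
    mono-split c v = begin
      mono c
        ≡⟨ sum-remove {i = v} (λ u → sum λ w → indicator (same c u w)) ⟩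
      sum (λ w → indicator (same c v w)) + sum (λ u → sum λ w → indicator (same c (punchIn v u) w))
        ≡⟨ cong₂ _+_ (row c v) (sum-cong-≗ λ u → sum-remove {i = v} λ w → indicator (same c (punchIn v u) w)) ⟩
      at c v + sum (λ u → indicator (same c (punchIn v u) v) + sum λ w → indicator (same c (punchIn v u) (punchIn v w)))
        ≡⟨ cong (at c v +_) (∑-distrib-+ _ (λ u → sum λ w → indicator (same c (punchIn v u) (punchIn v w)))) ⟩
      at c v + (sum (λ u → indicator (same c (punchIn v u) v)) + away c v)
        ≡⟨ cong (λ k → at c v + (k + away c v)) (sum-cong-≗ λ u → cong indicator (same-sym c (punchIn v u) v)) ⟩
      at c v + (at c v + away c v) ∎
      where open ≡-Reasoning

    flip : Fin (suc n) → Colouring → Colouring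
    flip v c = Functional.updateAt c v not

    flip-at : ∀ v c → flip v c v ≡ not (c v)
    flip-at v c = updateAt-updates v c

    flip-away : ∀ v c u → flip v c (punchIn v u) ≡ c (punchIn v u)
    flip-away v c u = updateAt-minimal (punchIn v u) v c (Fin.punchInᵢ≢i v u)

    away-flip : ∀ v c → away (flip v c) v ≡ away c v
    away-flip v c = sum-cong-≗ λ u → sum-cong-≗ λ w →
      cong₂ (λ a b → indicator (A _ _ ∧ (a == b))) (flip-away v c u) (flip-away v c w)

    complementary : ∀ a x y → indicator (a ∧ (not x == y)) + indicator (a ∧ (x == y)) ≡ indicator a
    complementary false _     _     = refl
    complementary true  true  true  = refl
    complementary true  true  false = refl
    complementary true  false true  = refl
    complementary true  false false = refl

    -- Each neighbour of `v` agrees with it in exactly one of the two colourings, so the sum is the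
    -- degree.
    at-flip : ∀ v c → at (flip v c) v + at c v ≤ 3
    at-flip v c = begin
      at (flip v c) v + at c v
        ≡⟨ ∑-distrib-+ (λ w → indicator (same (flip v c) v (punchIn v w))) _ ⟨
      sum (λ w → indicator (same (flip v c) v (punchIn v w)) + indicator (same c v (punchIn v w)))
        ≡⟨ sum-cong-≗ (λ w → trans
             (cong₂ (λ a b → indicator (A v (punchIn v w) ∧ (a == b)) + indicator (same c v (punchIn v w))) (flip-at v c) (flip-away v c w))
             (complementary (A v (punchIn v w)) (c v) (c (punchIn v w)))) ⟩
      sum (λ w → indicator (A v (punchIn v w)))
        ≤⟨ ℕ.m≤n+m _ (indicator (A v v)) ⟩
      indicator (A v v) + sum (λ w → indicator (A v (punchIn v w)))
        ≡⟨ sum-remove {i = v} (indicator ∘ A v) ⟨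
      sum (indicator ∘ A v)
        ≡⟨ length-filter≡sum (A v) id ⟨
      length (filter (T? ∘ A v) (allFin (suc n)))
        ≤⟨ degree≤3 v ⟩
      3 ∎
      where open ℕ.≤-Reasoning

    Clash : Colouring → Fin (suc n) → Fin (suc n) → Fin (suc n) → Set
    Clash c x y z = T (same c x y) × T (same c x z) × ¬ y ≡ z

    clash? : ∀ c → Dec (∃ λ x → ∃ λ y → ∃ λ z → Clash c x y z)
    clash? c = Fin.any? λ x → Fin.any? λ y → Fin.any? λ z → T? _ ×-dec T? _ ×-dec ¬? (y Fin.≟ z)

    clash-at : ∀ c {x y z} → Clash c x y z → 2 ≤ at c x
    clash-at c {x} {y} {z} (xy , xz , y≢z) = subst (2 ≤_) (trans (length-filter≡sum (same c x) id) (row c x))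
      (unique⊆⇒length≤ {xs = y ∷ z ∷ []} ((y≢z ∷ []) ∷ [] ∷ [])
        λ { (here refl) → ∈-filter⁺ (T? ∘ same c x) (∈-allFin y) xy
          ; (there (here refl)) → ∈-filter⁺ (T? ∘ same c x) (∈-allFin z) xz })

    flip-decreases : ∀ c {x y z} → Clash c x y z → mono (flip x c) < mono c
    flip-decreases c {x} clash = subst₂ _<_ (sym (mono-split (flip x c) x)) (sym (mono-split c x))
      (ℕ.+-mono-<-≤ at< (ℕ.+-mono-≤ (ℕ.<⇒≤ at<) (ℕ.≤-reflexive (away-flip x c))))
      where
      two : 2 ≤ at c x
      two = clash-at c clash
      at< : at (flip x c) x < at c x
      at< = ℕ.≤-trans (s≤s (ℕ.+-cancelʳ-≤ 2 _ 1 (ℕ.≤-trans (ℕ.+-monoʳ-≤ (at (flip x c) x) two) (at-flip x c)))) two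

    -- A vertex with two neighbours of its own colour has at most one of the other
    -- colour, so recolouring it removes a monochromatic edge.
    improve : ∀ c → Acc _<_ (mono c) → TwoColourable A
    improve c (acc rec) with clash? c
    ... | yes (x , y , z , clash) = improve (flip x c) (rec (flip-decreases c clash))
    ... | no ¬clash = c , λ x y z xy xz p q → decidable-stable (y Fin.≟ z) λ y≢z →
      ¬clash (x , y , z , from T-∧ (xy , subst (λ b → T (c x == b)) p (==-refl (c x)))
                        , from T-∧ (xz , subst (λ b → T (c x == b)) q (==-refl (c x))) , y≢z)

  maxDegree3-twoColourable : TwoColourable A
  maxDegree3-twoColourable = improve (λ _ → true) (<-wellFounded _)

-- The lower bound: padding to order 10 and relabelling the embedding.

∣p∣≤1 : ∀ {n} (p : Subset n) → (∀ x y → x ∈ˢ p → y ∈ˢ p → x ≡ y) → ∣ p ∣ ≤ 1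
∣p∣≤1 []            h = z≤n
∣p∣≤1 (outside ∷ p) h = ∣p∣≤1 p λ x y x∈ y∈ → Fin.suc-injective (h (suc x) (suc y) (Vec.there x∈) (Vec.there y∈))
∣p∣≤1 {suc n} (inside ∷ p) h = s≤s (ℕ.≤-reflexive (trans (cong ∣_∣ (Subset.Empty-unique empty)) (Subset.∣⊥∣≡0 n)))
  where
  empty : Empty p
  empty (x , x∈) = contradiction (h zero (suc x) Vec.here (Vec.there x∈)) λ ()

lookup-injective : ∀ {V : Set} {l} (L : Vec V l) → Unique (toList L) → ∀ i j → lookup L i ≡ lookup L j → i ≡ j
lookup-injective (x ∷ L) (_ ∷ _)  zero    zero    p = refl
lookup-injective (x ∷ L) (x∉ ∷ u) zero    (suc j) p = contradiction p (All.lookup x∉ (lookup-∈ L j))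
lookup-injective (x ∷ L) (x∉ ∷ u) (suc i) zero    p = contradiction (sym p) (All.lookup x∉ (lookup-∈ L i))
lookup-injective (x ∷ L) (_ ∷ u)  (suc i) (suc j) p = cong suc (lookup-injective L u i j p)

nonempty : ∀ {A : Set} {xs : List A} → 1 ≤ length xs → ∃ λ x → x ∈ xs
nonempty {xs = x ∷ xs} _ = x , here refl

-- The edge supplies the dart needed to have at least one component.
Certified : ∀ {N} → BoolRel N → Set
Certified {N} H = (∃₂ λ u v → T (H u v)) × ∃₂ λ k (L : Vec (Fin N) k) →
  toList L ↭ allFin N × Certificate (entry (matrix L))
  where open Adjacency H

module _ {N : ℕ} (H : BoolRel N) (H-sym : ∀ u v → H u v ≡ H v u) (H-irrefl : ∀ v → H v v ≡ false)
  (H-triangleFree : ∀ u v w → T (H u v) → T (H v w) → H u w ≡ false) where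

  open Adjacency H
  private
    vs = allFin N
    near = nbrsIn vs
    far  = othersIn vs

  -- The set `far v` contains `v` itself, so besides `v` at most five vertices lie outside its
  -- neighbourhood, within the range of the search.
  large-degree : N ≡ 10 → ∀ v → 4 ≤ length (near v) → TwoColourable H ⊎ Certified H
  large-degree N≡10 v big = pick (length (far v)) refl
    where
    total : length (near v) + length (far v) ≡ 10
    total = trans (sym (List.length-++ (near v))) (trans (↭-length (split-↭ v vs))
      (trans (List.length-tabulate {n = N} _) N≡10))
    v∈far : v ∈ far v
    v∈far = ∈-filter⁺ (λ x → H v x Bool.≟ false) (∈-allFin v) (H-irrefl v)
    neighbour = nonempty (ℕ.≤-trans (s≤s z≤n) big)
    pick : ∀ o → length (far v) ≡ o → TwoColourable H ⊎ Certified H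
    pick zero    eq with far v | v∈far
    pick zero    () | _ ∷ _ | _
    pick (suc r) eq with twoColourable-or-certificate H H-sym H-irrefl H-triangleFree ∈-allFin (Unique.allFin⁺ N) v r
        (search-≤5 r (ℕ.+-cancelˡ-≤ 4 r 5 (ℕ.≤-pred (ℕ.≤-trans
          (ℕ.+-mono-≤ (ℕ.≤-refl {5}) (ℕ.≤-refl {r})) (ℕ.≤-trans (ℕ.≤-reflexive (sym (ℕ.+-suc 4 r)))
            (ℕ.≤-trans (ℕ.+-monoˡ-≤ (suc r) big) (ℕ.≤-reflexive (trans (cong (length (near v) +_) (sym eq)) total))))))))
        (trans (sym (ℕ.+-suc (length (near v)) r)) (trans (cong (length (near v) +_) (sym eq)) total)) eq
    ... | inj₁ good = inj₁ good
    ... | inj₂ cert = inj₂ ((v , proj₁ neighbour , proj₂ (∈-filter⁻ (λ x → T? (H v x)) {xs = vs} (proj₂ neighbour))) , cert)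

twoColourable-or-certified : ∀ {N} → N ≡ 10 → (H : BoolRel N) (H-sym : ∀ u v → H u v ≡ H v u) (H-irrefl : ∀ v → H v v ≡ false)
  (H-triangleFree : ∀ u v w → T (H u v) → T (H v w) → H u w ≡ false) →
  TwoColourable H ⊎ Certified H
twoColourable-or-certified refl H H-sym H-irrefl H-triangleFree
  with Fin.any? (λ v → 4 ≤? length (Adjacency.nbrsIn H (allFin 10) v))
... | no ¬big       = inj₁ (maxDegree3-twoColourable H H-sym H-irrefl λ v → ℕ.≤-pred (ℕ.≰⇒> λ h → ¬big (v , h)))
... | yes (v , big) = large-degree H H-sym H-irrefl H-triangleFree refl v big

module _ {n k : ℕ} (G : Graph n) (triangleFree : TriangleFree G) where
  open Graph G

  adj-sym : ∀ u v → adj u v ≡ adj v u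
  adj-sym u v with adj u v in uv | adj v u in vu
  ... | true  | true  = refl
  ... | false | false = refl
  ... | true  | false = contradiction (symmetric u v (from T-≡ uv)) (subst (¬_ ∘ T) (sym vu) λ ())
  ... | false | true  = contradiction (symmetric v u (from T-≡ vu)) (subst (¬_ ∘ T) (sym uv) λ ())

  ¬T⇒false : ∀ {b} → ¬ T b → b ≡ false
  ¬T⇒false {false} _ = refl
  ¬T⇒false {true}  h = contradiction tt h

  link : Fin n ⊎ Fin k → Fin n ⊎ Fin k → Bool
  link (inj₁ u) (inj₁ v) = adj u v
  link _        _        = false

  padded : BoolRel (n + k)
  padded u v = link (splitAt n u) (splitAt n v)

  padded-sym : ∀ u v → padded u v ≡ padded v u
  padded-sym u v with splitAt n u | splitAt n v
  ... | inj₁ u | inj₁ v = adj-sym u v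
  ... | inj₁ _ | inj₂ _ = refl
  ... | inj₂ _ | inj₁ _ = refl
  ... | inj₂ _ | inj₂ _ = refl

  padded-irrefl : ∀ v → padded v v ≡ false
  padded-irrefl v with splitAt n v
  ... | inj₁ v = ¬T⇒false (irreflexive v)
  ... | inj₂ _ = refl

  padded-triangleFree : ∀ u v w → T (padded u v) → T (padded v w) → padded u w ≡ false
  padded-triangleFree u v w p q with splitAt n u | splitAt n v | splitAt n w
  ... | inj₁ u | inj₁ v | inj₁ w = ¬T⇒false (triangleFree u v w p q)
  ... | inj₁ u | inj₁ v | inj₂ w = refl
  ... | inj₂ u | _      | _      = refl

  padded-↑ˡ : ∀ u v → padded (u ↑ˡ k) (v ↑ˡ k) ≡ adj u v
  padded-↑ˡ u v = cong₂ link (Fin.splitAt-↑ˡ n u k) (Fin.splitAt-↑ˡ n v k)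

  padded⁻ : ∀ i j → T (padded i j) → ∃₂ λ u v → u ↑ˡ k ≡ i × v ↑ˡ k ≡ j × Adj u v
  padded⁻ i j p with splitAt n i in i≡ | splitAt n j in j≡
  ... | inj₁ u | inj₁ v = u , v , Fin.splitAt⁻¹-↑ˡ i≡ , Fin.splitAt⁻¹-↑ˡ j≡ , p

  twoColourable-colourable : TwoColourable padded → Colourable G 2 1
  twoColourable-colourable (c , h) = colour , λ i v v∈ → ∣p∣≤1 _ λ x y x∈ y∈ →
    let x∈ᶜ , x∈ᴺ = Subset.x∈p∩q⁻ (colourClass G colour i) (neighbours v) x∈
        y∈ᶜ , y∈ᴺ = Subset.x∈p∩q⁻ (colourClass G colour i) (neighbours v) y∈
    in Fin.↑ˡ-injective k x y (h (v ↑ˡ k) (x ↑ˡ k) (y ↑ˡ k)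
         (subst T (sym (padded-↑ˡ v x)) (neighbour x∈ᴺ)) (subst T (sym (padded-↑ˡ v y)) (neighbour y∈ᴺ))
         (colour-injective (trans (coloured v∈) (sym (coloured x∈ᶜ))))
         (colour-injective (trans (coloured v∈) (sym (coloured y∈ᶜ)))))
    where
    code : Bool → Fin 2
    code b = if b then zero else suc zero
    colour : Fin n → Fin 2
    colour v = code (c (v ↑ˡ k))
    colour-injective : ∀ {a b} → code a ≡ code b → a ≡ b
    colour-injective {true}  {true}  _ = refl
    colour-injective {false} {false} _ = refl
    coloured : ∀ {i x} → x ∈ˢ colourClass G colour i → colour x ≡ i
    coloured {i} {x} x∈ = toWitness (from T-≡ (trans (sym (lookup∘tabulate _ x)) ([]=⇒lookup x∈)))
    neighbour : ∀ {v x} → x ∈ˢ neighbours v → Adj v x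
    neighbour {v} {x} x∈ = from T-≡ (trans (sym (lookup∘tabulate (adj v) x)) ([]=⇒lookup x∈))

  module _ {m} (L : Vec (Fin (n + k)) m) (L↭ : toList L ↭ allFin (n + k)) where
    open Adjacency padded
    open RotationSystem

    private
      L-injective : ∀ {i j} → lookup L i ≡ lookup L j → i ≡ j
      L-injective = lookup-injective L (Permutationₛ.Unique-resp-↭ (setoid _) (↭⇒↭ₛ (↭-sym L↭)) (Unique.allFin⁺ (n + k))) _ _

      index : Fin n → Fin m
      index u = proj₁ (position L (∈-resp-↭ (↭-sym L↭) (∈-allFin (u ↑ˡ k))))

      index-lookup : ∀ u → lookup L (index u) ≡ u ↑ˡ k
      index-lookup u = proj₂ (position L (∈-resp-↭ (↭-sym L↭) (∈-allFin (u ↑ˡ k))))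

      index-injective : ∀ {u v} → index u ≡ index v → u ≡ v
      index-injective {u} {v} p = Fin.↑ˡ-injective k u v
        (trans (sym (index-lookup u)) (trans (cong (lookup L) p) (index-lookup v)))

      index-≡ : ∀ {u i} → u ↑ˡ k ≡ lookup L i → index u ≡ i
      index-≡ {u} p = L-injective (trans (index-lookup u) p)

      entry-index : ∀ u v → entry (matrix L) (index u) (index v) ≡ adj u v
      entry-index u v = trans (entry-matrix L (index u) (index v))
        (trans (cong₂ padded (index-lookup u) (index-lookup v)) (padded-↑ˡ u v))

      dart-cong : ∀ {d e : Dart G} → Dart.tail d ≡ Dart.tail e → Dart.head d ≡ Dart.head e → d ≡ e
      dart-cong {dart u v p} {dart _ _ q} refl refl = cong (dart u v) (T-irrelevant p q)

    -- Only the ends of darts are renamed. The added isolated vertices carry no darts, so the orbits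
    -- and Euler's formula carry over unchanged.
    relabelledMap : (ρ : RotationSystem G) → Spherical ρ → SphericalMap (entry (matrix L))
    relabelledMap ρ (V , E , F , C , vs , es , fs , cs , euler) = record
      { D                = Dart G
      ; tail             = index ∘ Dart.tail
      ; head             = index ∘ Dart.head
      ; rotate           = rotate ρ
      ; opposite         = reverse G
      ; adjacent         = λ d → subst T (sym (entry-index _ _)) (Dart.adjacent d)
      ; dartOf           = λ {i} {j} p → let u , v , u≡ , v≡ , e = padded⁻ _ _ (subst T (entry-matrix L i j) p)
                                         in dart u v e , index-≡ u≡ , index-≡ v≡
      ; dart-≡           = λ p q → dart-cong (index-injective p) (index-injective q)
      ; rotate-injective = λ {d} {e} p → trans (sym (Inverse.strictlyInverseʳ (rotation ρ) d))
                             (trans (cong (Inverse.from (rotation ρ)) p) (Inverse.strictlyInverseʳ (rotation ρ) e))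
      ; tail-opposite    = λ _ → refl
      ; head-opposite    = λ _ → refl
      ; cyclic           = λ d e → mk⇔ (to (cyclic ρ d e) ∘ index-injective) (cong index ∘ from (cyclic ρ d e))
      ; vertices         = vs
      ; edges            = es
      ; faces            = fs
      ; components       = cs
      ; euler            = euler
      }

    planar-uncertified : Planar G → (∃₂ λ u v → T (padded u v)) → ¬ Certificate (entry (matrix L))
    planar-uncertified (ρ , spherical) (i , j , ij) cert with u , v , _ , _ , e ← padded⁻ i j ij =
      no-certificate (relabelledMap ρ spherical)
        (λ v p → subst T (trans (entry-matrix L v v) (padded-irrefl _)) p)
        (λ u v w p q r → subst T (padded-triangleFree _ _ _ (subst T (entry-matrix L u v) p) (subst T (entry-matrix L v w) q))
           (subst T (entry-matrix L u w) r))
        (dart u v e) cert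

  planar-colourable : n + k ≡ 10 → Planar G → Colourable G 2 1
  planar-colourable n+k≡10 planar with twoColourable-or-certified n+k≡10 padded padded-sym padded-irrefl padded-triangleFree
  ... | inj₁ good                       = twoColourable-colourable good
  ... | inj₂ (edge , m , L , L↭ , cert) = contradiction cert (planar-uncertified L L↭ planar edge)

order≥11 : ∀ n → PlanarOrder 3 1 n → 11 ≤ n
order≥11 n (G , triangleFree , planar , _ , least) = ℕ.≰⇒> λ n≤10 →
  let k , n+k≡10 = ℕ.m≤n⇒∃[o]m+o≡n n≤10
  in contradiction (least 2 (planar-colourable {k = k} G triangleFree n+k≡10 planar)) λ { (s≤s (s≤s ())) }

-- The extremal graph of order 11 and its colourings.

open DecMembership (Fin._≟_ {11}) using (_∈?_)

-- The neighbours of each vertex, in the cyclic order of a plane drawing.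
around : Fin 11 → List (Fin 11)
around u = List.map (_mod 11) (lookup table u)
  where
  table : Vec (List ℕ) 11
  table = (6 ∷ 5 ∷ [])
        ∷ (4 ∷ 9 ∷ [])
        ∷ (10 ∷ 9 ∷ [])
        ∷ (10 ∷ 9 ∷ [])
        ∷ (1 ∷ 8 ∷ 7 ∷ [])
        ∷ (8 ∷ 10 ∷ 0 ∷ [])
        ∷ (0 ∷ 10 ∷ 8 ∷ [])
        ∷ (9 ∷ 4 ∷ 10 ∷ [])
        ∷ (9 ∷ 5 ∷ 6 ∷ 4 ∷ [])
        ∷ (2 ∷ 3 ∷ 8 ∷ 1 ∷ 7 ∷ [])
        ∷ (3 ∷ 2 ∷ 7 ∷ 6 ∷ 5 ∷ [])
        ∷ []

adjacent₁₁ : BoolRel 11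
adjacent₁₁ u v = ⌊ v ∈? around u ⌋

successor : Fin 11 → List (Fin 11) → Fin 11
successor v []       = v
successor v (x ∷ xs) = go x xs
  where
  go : Fin 11 → List (Fin 11) → Fin 11
  -- The cyclic order wraps around to the first entry.
  go y []       = x
  go y (z ∷ zs) with v Fin.≟ y
  ... | yes _ = z
  ... | no  _ = go z zs

next previous : Fin 11 → Fin 11 → Fin 11
next     u v = successor v (around u)
previous u v = successor v (List.reverse (around u))

adjacent₁₁? : ∀ u v → Dec (T (adjacent₁₁ u v))
adjacent₁₁? u v = T? (adjacent₁₁ u v)

G₁₁ : Graph 11
G₁₁ = record
  { adj         = adjacent₁₁
  ; symmetric   = toWitness {a? = Fin.all? λ u → Fin.all? λ v → adjacent₁₁? u v →-dec adjacent₁₁? v u} _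
  ; irreflexive = toWitness {a? = Fin.all? λ v → ¬? (adjacent₁₁? v v)} _
  }

open Graph G₁₁ using (neighbours)

G₁₁-triangleFree : TriangleFree G₁₁
G₁₁-triangleFree = toWitness {a? = Fin.all? λ u → Fin.all? λ v → Fin.all? λ w →
  adjacent₁₁? u v →-dec (adjacent₁₁? v w →-dec ¬? (adjacent₁₁? u w))} _

G₁₁-colourable : Colourable G₁₁ 3 1
G₁₁-colourable = colour , toWitness {a? = Fin.all? λ i → Fin.all? λ v →
    (v Subset.∈? colourClass G₁₁ colour i) →-dec ∣ colourClass G₁₁ colour i ∩ neighbours v ∣ ≤? 1} _
  where
  colour : Fin 11 → Fin 3
  colour = lookup (Vec.map (_mod 3) (0 ∷ 0 ∷ 0 ∷ 0 ∷ 1 ∷ 1 ∷ 1 ∷ 0 ∷ 0 ∷ 1 ∷ 2 ∷ []))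

sharers : Row 11 → Fin 11 → Subset 11
sharers b v = tabulate λ w → lookup b w == lookup b v

defect? : ∀ b → Dec (∃ λ v → ¬ ∣ sharers b v ∩ neighbours v ∣ ≤ 1)
defect? b = Fin.any? λ v → ¬? (∣ sharers b v ∩ neighbours v ∣ ≤? 1)

-- Exhaustive evaluation over the 2048 Boolean colourings.
all-defective : allRows 11 (λ b → ⌊ defect? b ⌋) ≡ true
all-defective = refl

allRows-true : ∀ k {P : Row k → Bool} → allRows k P ≡ true → ∀ r → P r ≡ true
allRows-true k {P} h r = to T-≡ (allRows-sound k P (from T-≡ h) r)

⌊⌋-witness : ∀ {P : Set} (a? : Dec P) → ⌊ a? ⌋ ≡ true → P
⌊⌋-witness (yes p) _ = p

defect : ∀ b → ∃ λ v → ¬ ∣ sharers b v ∩ neighbours v ∣ ≤ 1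
defect b = ⌊⌋-witness (defect? b) (allRows-true 11 {λ b → ⌊ defect? b ⌋} all-defective b)

-- With at most two colours, agreeing with a fixed colour z determines the colour.
two-colours : ∀ {j} → j ≤ 2 → ∀ (z x y : Fin j) → ⌊ x Fin.≟ y ⌋ ≡ (⌊ x Fin.≟ z ⌋ == ⌊ y Fin.≟ z ⌋)
two-colours {suc zero}       _ zero       zero       zero       = refl
two-colours {suc (suc zero)} _ zero       zero       zero       = refl
two-colours {suc (suc zero)} _ zero       zero       (suc zero) = refl
two-colours {suc (suc zero)} _ zero       (suc zero) zero       = refl
two-colours {suc (suc zero)} _ zero       (suc zero) (suc zero) = refl
two-colours {suc (suc zero)} _ (suc zero) zero       zero       = refl
two-colours {suc (suc zero)} _ (suc zero) zero       (suc zero) = refl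
two-colours {suc (suc zero)} _ (suc zero) (suc zero) zero       = refl
two-colours {suc (suc zero)} _ (suc zero) (suc zero) (suc zero) = refl
two-colours {suc (suc (suc j))} (_≤_.s≤s (_≤_.s≤s ()))

G₁₁-not-2-colourable : ∀ j → Colourable G₁₁ j 1 → 3 ≤ j
G₁₁-not-2-colourable j (c , h) = ℕ.≰⇒> λ j≤2 →
  -- Agreement with the colour of vertex `zero` turns a colouring with at most two colours into a
  -- Boolean row.
  let f = λ w → ⌊ c w Fin.≟ c zero ⌋
      b = tabulate f
      v , bad = defect b
      class≡ : colourClass G₁₁ c (c v) ≡ sharers b v
      class≡ = tabulate-cong λ w → trans (two-colours j≤2 (c zero) (c w) (c v))
        (sym (cong₂ _==_ (lookup∘tabulate f w) (lookup∘tabulate f v)))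
      v∈ = lookup⇒[]= v _ (trans (lookup∘tabulate (λ w → ⌊ c w Fin.≟ c v ⌋) v) (trans (isYes≗does (c v Fin.≟ c v)) (dec-true (c v Fin.≟ c v) refl)))
  in bad (subst (λ U → ∣ U ∩ neighbours v ∣ ≤ 1) class≡ (h (c v) v v∈))

-- A spherical rotation system on the extremal graph.

iterate-closure : ∀ {A : Set} (p : A → A) k x → EqClosure (Step p) x (iterate p k x)
iterate-closure p zero    x = EqClosure.reflexive _
iterate-closure p (suc k) x = EqClosure.transitive _ (iterate-closure p k x) (EqClosure.return refl)

-- Elements with equal labels are joined through their common root.
classCount : ∀ {A : Set} {R : Rel A 0ℓ} {c} (label : A → Fin c) (root : Fin c → A) →
  (∀ i → label (root i) ≡ i) → (∀ d e → R d e → label d ≡ label e) →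
  (∀ d → EqClosure R (root (label d)) d) → ClassCount R c
classCount {R = R} label root section invariant reach =
  mk↠ₛ {to = label} (λ i → root i , section i) , λ d e → mk⇔
    (λ eq → EqClosure.transitive R (EqClosure.symmetric R (reach d)) (subst (λ i → EqClosure R (root i) e) (sym eq) (reach e)))
    (EqClosure.gfold isEquivalence label (invariant _ _))

Dart₁₁ : Set
Dart₁₁ = Dart G₁₁

dart₁₁-≡ : ∀ {d e : Dart₁₁} → Dart.tail d ≡ Dart.tail e → Dart.head d ≡ Dart.head e → d ≡ e
dart₁₁-≡ {dart u v p} {dart _ _ q} refl refl = cong (dart u v) (T-irrelevant p q)

_≟ᵈ_ : (d e : Dart₁₁) → Dec (d ≡ e)
d ≟ᵈ e = map′ (λ (p , q) → dart₁₁-≡ p q) (λ { refl → refl , refl })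
  (Dart.tail d Fin.≟ Dart.tail e ×-dec Dart.head d Fin.≟ Dart.head e)

allDarts? : {P : Dart₁₁ → Set} → (∀ d → Dec (P d)) → Dec (∀ d → P d)
allDarts? P? = map′ (λ h (dart u v e) → h u v e) (λ h u v e → h (dart u v e))
  (Fin.all? λ u → Fin.all? λ v → all-T? λ e → P? (dart u v e))
  where
  all-T? : ∀ {b} {Q : T b → Set} → (∀ e → Dec (Q e)) → Dec (∀ e → Q e)
  all-T? {true}  Q? = map′ (λ q _ → q) (λ h → h _) (Q? _)
  all-T? {false} Q? = yes λ ()

rotate₁₁ rotate₁₁⁻¹ : Dart₁₁ → Dart₁₁
rotate₁₁ (dart u v e) = dart u (next u v) (next-adjacent u v e)
  where
  next-adjacent : ∀ u v → T (adjacent₁₁ u v) → T (adjacent₁₁ u (next u v))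
  next-adjacent = toWitness {a? = Fin.all? λ u → Fin.all? λ v → adjacent₁₁? u v →-dec adjacent₁₁? u (next u v)} _
rotate₁₁⁻¹ (dart u v e) = dart u (previous u v) (previous-adjacent u v e)
  where
  previous-adjacent : ∀ u v → T (adjacent₁₁ u v) → T (adjacent₁₁ u (previous u v))
  previous-adjacent = toWitness {a? = Fin.all? λ u → Fin.all? λ v → adjacent₁₁? u v →-dec adjacent₁₁? u (previous u v)} _

-- A label is found by searching the first `len` iterates of every root, so `len` must bound the
-- orbit lengths. Labels that are constant along `p` and distinct at the roots show that no two
-- roots share an orbit.
module Orbits (p : Dart₁₁ → Dart₁₁) {c} (roots : Vec Dart₁₁ c) (len : ℕ) where

  root : Fin c → Dart₁₁
  root = lookup roots

  located? : Dec (∀ d → ∃₂ λ i (k : Fin len) → iterate p (toℕ k) (root i) ≡ d)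
  located? = allDarts? λ d → Fin.any? λ i → Fin.any? λ k → iterate p (toℕ k) (root i) ≟ᵈ d

  module _ (located : True located?) where

    label : Dart₁₁ → Fin c
    label d = proj₁ (toWitness {a? = located?} located d)

    consistent? : Dec ((∀ i → label (root i) ≡ i) × (∀ d → label (p d) ≡ label d))
    consistent? = Fin.all? (λ i → label (root i) Fin.≟ i) ×-dec allDarts? (λ d → label (p d) Fin.≟ label d)

    orbits : True consistent? → ClassCount (Step p) c
    orbits ok = classCount label root (proj₁ (toWitness {a? = consistent?} ok)) (λ { d _ refl → sym (proj₂ (toWitness {a? = consistent?} ok) d) })
      λ d → let _ , k , eq = toWitness {a? = located?} located d in
        subst (EqClosure (Step p) (root (label d))) eq (iterate-closure p (toℕ k) (root (label d)))

arc : (u v : ℕ) → {True (adjacent₁₁? (u mod 11) (v mod 11))} → Dart₁₁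
arc u v {e} = dart (u mod 11) (v mod 11) (toWitness e)

firstDart : ∀ u → ∃ λ v → T (adjacent₁₁ u v)
firstDart = toWitness {a? = Fin.all? λ u → Fin.any? λ v → adjacent₁₁? u v} _

baseDart : Fin 11 → Dart₁₁
baseDart u = dart u _ (proj₂ (firstDart u))

vertexCount : ClassCount (Step rotate₁₁) 11
vertexCount = classCount Dart.tail baseDart (λ _ → refl) (λ { _ _ refl → refl }) λ d →
  let k , eq = reached d in subst (EqClosure (Step rotate₁₁) _) eq (iterate-closure rotate₁₁ (toℕ k) _)
  where
  -- Five is the maximum degree.
  reached : ∀ d → ∃ λ (k : Fin 5) → iterate rotate₁₁ (toℕ k) (baseDart (Dart.tail d)) ≡ d
  reached = toWitness {a? = allDarts? λ d → Fin.any? λ k → iterate rotate₁₁ (toℕ k) (baseDart (Dart.tail d)) ≟ᵈ d} _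

edgeCount : ClassCount (Step (reverse G₁₁)) 17
edgeCount = Orbits.orbits (reverse G₁₁)
  (arc 0 5 ∷ arc 0 6 ∷ arc 1 4 ∷ arc 1 9 ∷ arc 2 9 ∷ arc 2 10 ∷ arc 3 9 ∷ arc 3 10 ∷ arc 4 7 ∷ arc 4 8 ∷
   arc 5 8 ∷ arc 5 10 ∷ arc 6 8 ∷ arc 6 10 ∷ arc 7 9 ∷ arc 7 10 ∷ arc 8 9 ∷ []) 2 _ _

-- The 34 darts form six quadrangles and two pentagons, whence the orbit bound 5.
faceCount : ClassCount (Step (rotate₁₁ ∘ reverse G₁₁)) 8
faceCount = Orbits.orbits (rotate₁₁ ∘ reverse G₁₁)
  (arc 0 6 ∷ arc 0 5 ∷ arc 1 4 ∷ arc 1 9 ∷ arc 2 10 ∷ arc 2 9 ∷ arc 3 9 ∷ arc 4 7 ∷ []) 5 _ _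

rotationSystem : RotationSystem G₁₁
rotationSystem = record
  { rotation = mk↔ₛ′ rotate₁₁ rotate₁₁⁻¹
      (toWitness {a? = allDarts? λ d → rotate₁₁ (rotate₁₁⁻¹ d) ≟ᵈ d} _)
      (toWitness {a? = allDarts? λ d → rotate₁₁⁻¹ (rotate₁₁ d) ≟ᵈ d} _)
  ; cyclic   = proj₂ vertexCount
  }

open RotationSystem rotationSystem using (Linked)

-- The parent of a vertex in a spanning tree rooted at 10.
parent : Fin 11 → Fin 11
parent = lookup (Vec.map (_mod 11) (5 ∷ 4 ∷ 10 ∷ 10 ∷ 7 ∷ 10 ∷ 10 ∷ 10 ∷ 5 ∷ 7 ∷ 5 ∷ []))

-- Rotate to the dart towards the parent, reverse it, and rotate there to `e`.
parent-linked : ∀ d e → Dart.tail e ≡ parent (Dart.tail d) → EqClosure Linked d e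
parent-linked d e eq = EqClosure.transitive _ (around-vertex refl)
  (EqClosure.transitive _ (EqClosure.return (inj₂ refl)) (around-vertex {reverse G₁₁ up} (sym eq)))
  where
  up : Dart₁₁
  up = dart (Dart.tail d) (parent (Dart.tail d)) (toWitness {a? = Fin.all? λ u → adjacent₁₁? u (parent u)} _ (Dart.tail d))
  around-vertex : ∀ {d e : Dart₁₁} → Dart.tail d ≡ Dart.tail e → EqClosure Linked d e
  around-vertex {d} {e} p = EqClosure.map inj₁ (to (proj₂ vertexCount d e) p)

ancestor-linked : ∀ k d e → Dart.tail e ≡ iterate parent (suc k) (Dart.tail d) → EqClosure Linked d e
ancestor-linked zero    d e eq = parent-linked d e eq
ancestor-linked (suc k) d e eq = EqClosure.transitive _ (ancestor-linked k d (baseDart _) refl) (parent-linked (baseDart _) e eq)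

componentCount : ClassCount Linked 1
componentCount = classCount (λ _ → zero) (λ _ → baseDart (10 mod 11)) (λ { zero → refl ; (suc ()) }) (λ _ _ _ → refl) λ d →
  let k , eq = depth (Dart.tail d) in EqClosure.symmetric _ (ancestor-linked (toℕ k) d (baseDart (10 mod 11)) (sym eq))
  where
  -- Three steps suffice, and at least one is taken: the root 10 has parent 5 and returns to itself
  -- in two.
  depth : ∀ u → ∃ λ (k : Fin 3) → iterate parent (suc (toℕ k)) u ≡ 10 mod 11
  depth = toWitness {a? = Fin.all? λ u → Fin.any? λ k → iterate parent (suc (toℕ k)) u Fin.≟ (10 mod 11)} _

G₁₁-planar : Planar G₁₁
G₁₁-planar = rotationSystem , 11 , 17 , 8 , 1 , vertexCount , edgeCount , faceCount , componentCount , refl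

planarOrder-11 : PlanarOrder 3 1 11
planarOrder-11 = G₁₁ , G₁₁-triangleFree , G₁₁-planar , G₁₁-colourable , G₁₁-not-2-colourable

theorem4p2 : MinimumPlanarOrder 3 1 11
theorem4p2 = planarOrder-11 , order≥11
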